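{- Let $n\ge 3$ and let $\Pi'_n=a_1a_2\cdots a_{n!+n-1}$ be the output of the greedy algorithm described in the context, and for $1\le k\le n!$ let $\sigma_k=\mathrm{red}(a_k a_{k+1}\cdots a_{k+n-1})$. Then $a_{\frac{n!}{2}+1}=1$, $$\sigma_{\frac{n!}{2}}=n12\cdots(n-1),\qquad \sigma_{\frac{n!}{2}+1}=134\cdots n2,\qquad \sigma_{\frac{n!}{2}+2}=23\cdots(n-1)1n,$$ and $$\{\sigma_k:\ 1\le k\le n!/2\}=S_{n,1},\qquad \{\sigma_k:\ n!/2<k\le n!\}=S_{1,n},$$ where $S_{1,n}$ (resp. $S_{n,1}$) is the set of permutations of $\{1,\dots,n\}$ in which the entry $1$ appears before (resp. after) the entry $n$.
   Context: For a word $w$ of distinct integers, $\mathrm{red}(w)$ denotes the word obtained by replacing the $i$-th smallest entry of $w$ by $i$. A factor of a word is a block of consecutive letters. Extensions: for a word $\pi=\pi_1\cdots\pi_m$ of distinct integers and $1\le i\le m$, the $i$-th extension of $\pi$ is $c_b(\pi_1)\cdots c_b(\pi_m)\,b$, where $b$ is the $i$-th smallest element of $\{\pi_1,\dots,\pi_m\}$ and $c_b(x)=x$ if $x<b$, $c_b(x)=x+1$ if $x\ge b$. The $(m+1)$-st extension of $\pi$ is $\pi b$ with $b=\max_j\pi_j+1$. Greedy algorithm: start with $\Pi'_{n,0}=12\cdots(n-1)$. Given $\Pi'_{n,k}=a_1a_2\cdots a_{k+n-1}$ (a permutation of $\{1,\dots,k+n-1\}$ in which no two factors of length $n$ have the same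 reduced form), let $i\in\{1,\dots,n\}$ be minimal such that the $i$-th extension of $a_{k+1}\cdots a_{k+n-1}$ has reduced form different from the reduced form of every length-$n$ factor of $\Pi'_{n,k}$, let $b$ be the last element of this extension, and set $\Pi'_{n,k+1}=c_b(a_1)\cdots c_b(a_{k+n-1})\,b$. If no such $i$ exists, the algorithm terminates and outputs $\Pi'_n:=\Pi'_{n,k}$. The output $\Pi'_n$ is a permutation of $\{1,\dots,n!+n-1\}$ whose $n!$ length-$n$ factors have pairwise distinct reduced forms covering all permutations of $\{1,\dots,n\}$. -}

module Defs where


open import Data.Nat using (ℕ; zero; suc; _+_; _∸_; _<_; _<ᵇ_; _≡ᵇ_; _⊔_; _!)
open import Data.Bool using (Bool; true; false; if_then_else_; _∧_; _∨_; not)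
open import Data.List using (List; []; _∷_; map; filter; length; take; drop; upTo; head; foldr; _++_; [_])
open import Data.Maybe using (Maybe; just; nothing)
open import Data.Product using (Σ; _×_; ∃-syntax)
open import Relation.Binary.PropositionalEquality using (_≡_)

countBelow : List ℕ → ℕ → ℕ
countBelow w x = foldr (λ y acc → if y <ᵇ x then suc acc else acc) 0 w

-- red(w): replace the i-th smallest entry by i (entries assumed distinct)
red : List ℕ → List ℕ
red w = map (λ x → suc (countBelow w x)) w

c : ℕ → ℕ → ℕ
c b x = if x <ᵇ b then x else suc x

maxL : List ℕ → ℕ
maxL = foldr _⊔_ 0

-- i-th smallest element (1-based) of a word of distinct integers
ithSmallest : List ℕ → ℕ → Maybe ℕ
ithSmallest π i = head (filter' π)
  where
  filter' : List ℕ → List ℕ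
  filter' [] = []
  filter' (x ∷ xs) = if countBelow π x ≡ᵇ (i ∸ 1) then x ∷ filter' xs else filter' xs

-- the element b appended by the i-th extension of π (1 ≤ i ≤ m+1, m = |π|)
extB : List ℕ → ℕ → Maybe ℕ
extB π i = if length π <ᵇ i then just (suc (maxL π)) else ithSmallest π i

extension : List ℕ → ℕ → Maybe (List ℕ)
extension π i with extB π i
... | just b = just (map (c b) π ++ [ b ])
... | nothing = nothing

eqList : List ℕ → List ℕ → Bool
eqList [] [] = true
eqList (x ∷ xs) (y ∷ ys) = (x ≡ᵇ y) ∧ eqList xs ys
eqList _ _ = false

memList : List ℕ → List (List ℕ) → Bool
memList w [] = false
memList w (v ∷ vs) = eqList w v ∨ memList w vs

factors : ℕ → List ℕ → List (List ℕ)
factors n a = map (λ k → take n (drop k a)) (upTo (suc (length a) ∸ n))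

greedyStep : ℕ → List ℕ → Maybe (List ℕ)
greedyStep n a = try (map suc (upTo n))
  where
  window : List ℕ
  window = drop (length a ∸ (n ∸ 1)) a
  used : List (List ℕ)
  used = map red (factors n a)
  try : List ℕ → Maybe (List ℕ)
  try [] = nothing
  try (i ∷ is) with extension window i
  ... | nothing = try is
  ... | just e with memList (red e) used | extB window i
  ...   | false | just b = just (map (c b) a ++ [ b ])
  ...   | _ | _ = try is

greedyRun : ℕ → ℕ → List ℕ → List ℕ
greedyRun n zero a = a
greedyRun n (suc fuel) a with greedyStep n a
... | nothing = a
... | just a' = greedyRun n fuel a'

-- Π'_n. Each step adds a new length-n factor with a new reduced form, so at most
-- n! steps can occur; hence fuel n! (+1 for safety) yields the genuine output.
Pi' : ℕ → List ℕ
Pi' n = greedyRun n (suc (n !)) (map suc (upTo (n ∸ 1)))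

-- 1-based entry access
entry : List ℕ → ℕ → Maybe ℕ
entry w j = head (drop (j ∸ 1) w)

sigma : ℕ → List ℕ → ℕ → List ℕ
sigma n a k = red (take n (drop (k ∸ 1) a))

Before : ℕ → ℕ → List ℕ → Set
Before x y p = ∃[ i ] ∃[ j ] (i < j × entry p i ≡ just x × entry p j ≡ just y)

{-# OPTIONS --safe #-}
module Submission where

open import Defs
open import Data.Nat using (ℕ; suc; _+_; _∸_; _≤_; _<_; _!)
open import Data.Nat.DivMod using (_/_)
open import Data.List using (List; []; _∷_; map; upTo; _++_; [_])
open import Data.Maybe using (just)
open import Data.Product using (_×_; ∃-syntax)
open import Function.Bundles using (_⇔_)
open import Relation.Binary.PropositionalEquality using (_≡_)
open import Data.List.Relation.Binary.Permutation.Propositional using (_↭_)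

open import Data.Bool using (Bool; true; false; if_then_else_; not)
open import Data.Bool.Properties using (∨-zeroʳ)
open import Data.List using (applyUpTo; cartesianProductWith; drop; filter; head; initLast; length; reverse; take; _∷ʳ_; _∷ʳ′_)
open import Data.List.Membership.Propositional using (_∈_; _∉_)
open import Data.List.Membership.Propositional.Properties using (∈-++⁺ʳ; ∈-++⁺ˡ; ∈-++⁻; ∈-cartesianProductWith⁺; ∈-cartesianProductWith⁻; ∈-filter⁻; ∈-map⁺; ∈-map⁻; ∈-upTo⁺; ∈-upTo⁻; ∈-∃++)
open import Data.List.Properties using (++-assoc; ++-identityʳ; drop-drop; drop-map; length-++; length-drop; length-map; length-reverse; length-upTo; map-++; map-cong-local; map-id-local; map-injective; map-upTo; map-∘; reverse-++; reverse-injective; take-all; take-map; unfold-reverse; upTo-∷ʳ; ≡-dec; ∷-injective; ∷ʳ-++; ∷ʳ-injective)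
open import Data.List.Relation.Binary.Permutation.Propositional using (prep; refl; swap; trans; ↭-refl; ↭-reflexive; ↭-sym; ↭⇒↭ₛ)
open import Data.List.Relation.Binary.Permutation.Propositional.Properties using (drop-∷; map⁺; shift; ∈-resp-↭; ∷↭∷ʳ; ↭-length; ↭-map-inv; ↭-reverse)
import Data.List.Relation.Binary.Permutation.Setoid.Properties as Permutationₛ
open import Data.List.Relation.Unary.All as All using (All; []; _∷_)
open import Data.List.Relation.Unary.All.Properties using (drop⁺; ¬Any⇒All¬; ++⁻ʳ; ++⁻ˡ) renaming (++⁺ to All-++⁺; map⁺ to All-map⁺)
open import Data.List.Relation.Unary.AllPairs using (AllPairs; []; _∷_)
open import Data.List.Relation.Unary.AllPairs.Properties using () renaming (++⁺ to AllPairs-++⁺)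
open import Data.List.Relation.Unary.Any using (here; there)
open import Data.List.Relation.Unary.Unique.Propositional using (Unique)
import Data.List.Relation.Unary.Unique.Propositional.Properties as Unique
open import Data.Maybe using (Maybe; nothing)
open import Data.Maybe.Properties using (just-injective)
open import Data.Nat using (zero; s<s; s≤s; s≤s⁻¹; z<s; z≤n; _*_; _<?_; _<ᵇ_; _≟_; _≡ᵇ_)
open import Data.Nat.DivMod using (m*n/n≡m)
open import Data.Nat.Properties hiding (_≟_; _<?_; _≤?_)
open import Data.Product using (proj₁; proj₂; _,_)
open import Data.Sum using (inj₁; inj₂)
open import Function using (_∘_)
open import Function.Bundles using (mk⇔)
open import Level using (0ℓ)
open import Relation.Binary using (DecidableEquality)
open import Relation.Binary.PropositionalEquality using (cong; cong₂; refl; setoid; subst; subst₂; sym; _≢_; module ≡-Reasoning) renaming (trans to ≡-trans)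
open import Relation.Nullary using (contradiction; does; no; yes; ¬_; Dec)
open import Relation.Unary using (Decidable; Pred)

-- Put m = n − 1. The algorithm walks on the graph whose vertices are the permutations of length m and
-- whose edges are those of length n, σ leading from red(σ₁…σₘ) to red(σ₂…σₙ); it leaves a vertex for the
-- k-th time along its k-th extension. For such a walk from s = 12…m, suppose that only the first d(v)
-- edges leaving v are allowed, that at most d(v) of the allowed edges enter v, and that following last
-- allowed edges leads from every vertex to s. Then the walk can only get stuck at s, where its balance
-- is zero at every vertex; an edge left unused at v would leave the last edge of v unused, hence also
-- an edge leaving its target, and so on up to s, which is exhausted.
--
-- This applies to d = n, and also to d(v) = m or 1 according to whether the maximum of v precedes its
-- minimum or not: the allowed edges are then exactly the permutations with n before 1. As they come first
-- at every vertex, the second walk is an initial segment of the first one, it ends in s, and reversal of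
-- words shows that it is half of it. During the first half the window always contains the letter 1; in
-- the second half no extension is the first one, so that this 1 is never shifted.

private variable
  A B : Set

-- Words and reduced forms

<ᵇ-true : ∀ {x y} → x < y → (x <ᵇ y) ≡ true
<ᵇ-true {zero}  {suc y} _       = refl
<ᵇ-true {suc x} {suc y} (s≤s p) = <ᵇ-true p

<ᵇ-false : ∀ {x y} → y ≤ x → (x <ᵇ y) ≡ false
<ᵇ-false {x}     {zero}  _       = refl
<ᵇ-false {suc x} {suc y} (s≤s p) = <ᵇ-false p

<ᵇ-cong : ∀ {x y z w} → (x < y → z < w) → (z < w → x < y) → (z <ᵇ w) ≡ (x <ᵇ y)
<ᵇ-cong {x} {y} {z} {w} f g with x <? y
... | yes p = ≡-trans (<ᵇ-true (f p)) (sym (<ᵇ-true p))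
... | no ¬p = ≡-trans (<ᵇ-false (≮⇒≥ (¬p ∘ g))) (sym (<ᵇ-false (≮⇒≥ ¬p)))

c-below : ∀ {b x} → x < b → c b x ≡ x
c-below p rewrite <ᵇ-true p = refl

c-above : ∀ {b x} → b ≤ x → c b x ≡ suc x
c-above p rewrite <ᵇ-false p = refl

c-suc : ∀ b x → c (suc b) (suc x) ≡ suc (c b x)
c-suc b x with x <ᵇ b
... | true  = refl
... | false = refl

c-mono-< : ∀ b {x y} → x < y → c b x < c b y
c-mono-< b {x} {y} x<y with x <? b | y <? b
... | yes p | yes q rewrite c-below p | c-below q = x<y
... | yes p | no q  rewrite c-below p | c-above (≮⇒≥ q) = m<n⇒m<1+n x<y
... | no p  | yes q = contradiction (<-trans x<y q) p
... | no p  | no q  rewrite c-above (≮⇒≥ p) | c-above (≮⇒≥ q) = s<s x<y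

c-mono-≤ : ∀ b {x y} → x ≤ y → c b x ≤ c b y
c-mono-≤ b x≤y with m≤n⇒m<n∨m≡n x≤y
... | inj₁ x<y  = <⇒≤ (c-mono-< b x<y)
... | inj₂ refl = ≤-refl

c-cancel-< : ∀ b {x y} → c b x < c b y → x < y
c-cancel-< b {x} {y} p with x <? y
... | yes x<y = x<y
... | no x≮y  = contradiction (c-mono-≤ b (≮⇒≥ x≮y)) (<⇒≱ p)

c-injective : ∀ b {x y} → c b x ≡ c b y → x ≡ y
c-injective b eq = ≤-antisym (≮⇒≥ λ q → <-irrefl (sym eq) (c-mono-< b q))
                             (≮⇒≥ λ q → <-irrefl eq (c-mono-< b q))

c-≢ : ∀ b x → c b x ≢ b
c-≢ b x eq with x <? b
... | yes p = <-irrefl (≡-trans (sym (c-below p)) eq) p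
... | no p  = <-irrefl (≡-trans (sym eq) (c-above (≮⇒≥ p))) (s≤s (≮⇒≥ p))

c-<⇒< : ∀ b {x} → c b x < b → x < b
c-<⇒< b {x} p with x <? b
... | yes q = q
... | no q  = contradiction (subst (_< b) (c-above (≮⇒≥ q)) p) (≤⇒≯ (m≤n⇒m≤1+n (≮⇒≥ q)))

map-c-below : ∀ {b w} → All (_< b) w → map (c b) w ≡ w
map-c-below = map-id-local ∘ All.map c-below

countBelow-++ : ∀ u v x → countBelow (u ++ v) x ≡ countBelow u x + countBelow v x
countBelow-++ []      v x = refl
countBelow-++ (y ∷ u) v x with y <ᵇ x
... | true  = cong suc (countBelow-++ u v x)
... | false = countBelow-++ u v x

countBelow-mono : ∀ w {x y} → x ≤ y → countBelow w x ≤ countBelow w y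
countBelow-mono [] _ = z≤n
countBelow-mono (z ∷ w) {x} {y} x≤y with z <? x | z <? y
... | yes p | yes q rewrite <ᵇ-true p | <ᵇ-true q = s≤s (countBelow-mono w x≤y)
... | yes p | no q  = contradiction (<-≤-trans p x≤y) q
... | no p  | yes q rewrite <ᵇ-false (≮⇒≥ p) | <ᵇ-true q = m≤n⇒m≤1+n (countBelow-mono w x≤y)
... | no p  | no q  rewrite <ᵇ-false (≮⇒≥ p) | <ᵇ-false (≮⇒≥ q) = countBelow-mono w x≤y

countBelow-strict : ∀ {w x y} → x ∈ w → x < y → countBelow w x < countBelow w y
countBelow-strict {z ∷ w} {x} {y} (here refl) x<y
  rewrite <ᵇ-false (≤-refl {x}) | <ᵇ-true x<y = s≤s (countBelow-mono w (<⇒≤ x<y))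
countBelow-strict {z ∷ w} {x} {y} (there x∈w) x<y with z <? x | z <? y
... | yes p | yes q rewrite <ᵇ-true p | <ᵇ-true q = s≤s (countBelow-strict x∈w x<y)
... | yes p | no q  = contradiction (<-trans p x<y) q
... | no p  | yes q rewrite <ᵇ-false (≮⇒≥ p) | <ᵇ-true q = m<n⇒m<1+n (countBelow-strict x∈w x<y)
... | no p  | no q  rewrite <ᵇ-false (≮⇒≥ p) | <ᵇ-false (≮⇒≥ q) = countBelow-strict x∈w x<y

countBelow-cancel-< : ∀ w {x y} → countBelow w x < countBelow w y → x < y
countBelow-cancel-< w {x} {y} p with x <? y
... | yes q = q
... | no q  = contradiction (countBelow-mono w (≮⇒≥ q)) (<⇒≱ p)

countBelow-map : ∀ (f : ℕ → ℕ) w x z → (∀ {y} → y ∈ w → (f y <ᵇ z) ≡ (y <ᵇ x)) →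
                 countBelow (map f w) z ≡ countBelow w x
countBelow-map f []      x z h = refl
countBelow-map f (y ∷ w) x z h rewrite h (here refl) =
  cong (λ k → if y <ᵇ x then suc k else k) (countBelow-map f w x z (h ∘ there))

countBelow-all : ∀ {w x} → All (_< x) w → countBelow w x ≡ length w
countBelow-all []       = refl
countBelow-all (p ∷ ps) rewrite <ᵇ-true p = cong suc (countBelow-all ps)

countBelow-none : ∀ {w x} → All (x ≤_) w → countBelow w x ≡ 0
countBelow-none []       = refl
countBelow-none (p ∷ ps) rewrite <ᵇ-false p = countBelow-none ps

countBelow-pos : ∀ {w x} → 0 < countBelow w x → ∃[ y ] (y ∈ w × y < x)
countBelow-pos {y ∷ w} {x} p with y <? x
... | yes q = y , here refl , q
... | no q rewrite <ᵇ-false (≮⇒≥ q) with z , z∈w , z<x ← countBelow-pos {w} p = z , there z∈w , z<x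

countBelow-↭ : ∀ {w w′} x → w ↭ w′ → countBelow w x ≡ countBelow w′ x
countBelow-↭ x refl = refl
countBelow-↭ x (prep y p) = cong (λ k → if y <ᵇ x then suc k else k) (countBelow-↭ x p)
countBelow-↭ x (swap y z p) with y <ᵇ x | z <ᵇ x
... | true  | true  = cong (suc ∘ suc) (countBelow-↭ x p)
... | true  | false = cong suc (countBelow-↭ x p)
... | false | true  = cong suc (countBelow-↭ x p)
... | false | false = countBelow-↭ x p
countBelow-↭ x (trans p q) = ≡-trans (countBelow-↭ x p) (countBelow-↭ x q)

rank : List ℕ → ℕ → ℕ
rank w x = suc (countBelow w x)

rank-<ᵇ : ∀ w {x} y → x ∈ w → (rank w x <ᵇ rank w y) ≡ (x <ᵇ y)
rank-<ᵇ w {x} y x∈w = <ᵇ-cong {x} {y} (s<s ∘ countBelow-strict x∈w) (countBelow-cancel-< w ∘ s≤s⁻¹)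

-- Ranks depend only on comparisons between letters of the word, so a relabelling that keeps these
-- changes no rank.
red-map : ∀ (f : ℕ → ℕ) w → (∀ {x y} → x ∈ w → y ∈ w → (f x <ᵇ f y) ≡ (x <ᵇ y)) →
          red (map f w) ≡ red w
red-map f w h = begin
  map (rank (map f w)) (map f w) ≡⟨ sym (map-∘ w) ⟩
  map (rank (map f w) ∘ f) w
    ≡⟨ map-cong-local (All.tabulate λ {x} x∈w → cong suc (countBelow-map f w x (f x) λ y∈w → h y∈w x∈w)) ⟩
  map (rank w) w                 ∎
  where open ≡-Reasoning

c-<ᵇ : ∀ b x y → (c b x <ᵇ c b y) ≡ (x <ᵇ y)
c-<ᵇ b x y = <ᵇ-cong (c-mono-< b) (c-cancel-< b)

red-map-c : ∀ b w → red (map (c b) w) ≡ red w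
red-map-c b w = red-map (c b) w λ {x} {y} _ _ → c-<ᵇ b x y

length-red : ∀ w → length (red w) ≡ length w
length-red w = length-map (rank w) w

-- The (i+1)-st extension of a reduced word: the label i counts the letters below the new one.
ext : List ℕ → ℕ → List ℕ
ext v i = map (c (suc i)) v ++ [ suc i ]

-- `c b` opens a gap at b and keeps the order of the old letters; the new letter raises by one the
-- rank of exactly those letters that were at least b. Extending a concrete window thus amounts to
-- following an edge of the graph, labelled by `countBelow w b`.
red-ext : ∀ w b → red (map (c b) w ++ [ b ]) ≡ ext (red w) (countBelow w b)
red-ext w b = begin
  map (rank e) (map (c b) w ++ [ b ])            ≡⟨ map-++ (rank e) (map (c b) w) [ b ] ⟩
  map (rank e) (map (c b) w) ++ [ rank e b ]
    ≡⟨ cong₂ (λ u k → u ++ [ suc k ]) (≡-trans (sym (map-∘ w)) (≡-trans (map-cong-local (All.tabulate old)) (map-∘ w))) new ⟩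
  map (c (rank w b)) (map (rank w) w) ++ [ rank w b ] ∎
  where
  open ≡-Reasoning
  e = map (c b) w ++ [ b ]
  count-e : ∀ x → countBelow e x ≡ countBelow (map (c b) w) x + countBelow [ b ] x
  count-e = countBelow-++ (map (c b) w) [ b ]
  new : countBelow e b ≡ countBelow w b
  new = begin
    countBelow e b                                    ≡⟨ count-e b ⟩
    countBelow (map (c b) w) b + countBelow [ b ] b
      ≡⟨ cong₂ _+_ (countBelow-map (c b) w b b λ {y} _ → <ᵇ-cong {y} (λ p → subst (_< b) (sym (c-below p)) p) (c-<⇒< b))
                   (countBelow-none (≤-refl {b} ∷ [])) ⟩
    countBelow w b + 0                                ≡⟨ +-identityʳ _ ⟩
    countBelow w b                                    ∎
  count-c : ∀ x → countBelow (map (c b) w) (c b x) ≡ countBelow w x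
  count-c x = countBelow-map (c b) w x (c b x) λ {y} _ → c-<ᵇ b y x
  old : ∀ {x} → x ∈ w → rank e (c b x) ≡ c (rank w b) (rank w x)
  old {x} x∈w with x <? b
  ... | yes x<b = begin
    rank e (c b x)                            ≡⟨ cong suc (count-e (c b x)) ⟩
    suc (countBelow (map (c b) w) (c b x) + countBelow [ b ] (c b x))
      ≡⟨ cong₂ (λ i j → suc (i + j)) (count-c x) (countBelow-none (subst (_≤ b) (sym (c-below x<b)) (<⇒≤ x<b) ∷ [])) ⟩
    suc (countBelow w x + 0)                  ≡⟨ cong suc (+-identityʳ _) ⟩
    rank w x                                  ≡⟨ sym (c-below (s<s (countBelow-strict x∈w x<b))) ⟩
    c (rank w b) (rank w x)                   ∎
  ... | no x≮b = begin
    rank e (c b x)                            ≡⟨ cong suc (count-e (c b x)) ⟩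
    suc (countBelow (map (c b) w) (c b x) + countBelow [ b ] (c b x))
      ≡⟨ cong₂ (λ i j → suc (i + j)) (count-c x) (countBelow-all (subst (b <_) (sym (c-above b≤x)) (s≤s b≤x) ∷ [])) ⟩
    suc (countBelow w x + 1)                  ≡⟨ cong suc (+-comm _ 1) ⟩
    suc (rank w x)                            ≡⟨ sym (c-above (s≤s (countBelow-mono w b≤x))) ⟩
    c (rank w b) (rank w x)                   ∎
    where b≤x = ≮⇒≥ x≮b

∈-drop : ∀ {x : A} k {w} → x ∈ drop k w → x ∈ w
∈-drop zero    p = p
∈-drop (suc k) {y ∷ w} p = there (∈-drop k p)

red-drop-red : ∀ k w → red (drop k (red w)) ≡ red (drop k w)
red-drop-red k w rewrite drop-map {f = rank w} k w =
  red-map (rank w) (drop k w) λ {x} {y} x∈ _ → rank-<ᵇ w y (∈-drop k x∈)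

-- Endpoint of the edge with label i that leaves the vertex v.
next : List ℕ → ℕ → List ℕ
next v i = red (drop 1 (ext v i))

next-red : ∀ w b → next (red w) (countBelow w b) ≡ red (drop 1 (map (c b) w ++ [ b ]))
next-red w b = ≡-trans (cong (red ∘ drop 1) (sym (red-ext w b))) (red-drop-red 1 (map (c b) w ++ [ b ]))

-- Permutations of 1, ..., m: insertion, deletion and counting

range : ℕ → List ℕ
range m = map suc (upTo m)

IsPerm : ℕ → List ℕ → Set
IsPerm m v = v ↭ range m

upTo-suc : ∀ m → upTo (suc m) ≡ 0 ∷ map suc (upTo m)
upTo-suc m = cong (0 ∷_) (sym (map-upTo suc m))

range-suc : ∀ m → range (suc m) ≡ 1 ∷ map suc (range m)
range-suc m = cong (map suc) (upTo-suc m)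

range-∷ʳ : ∀ m → range (suc m) ≡ range m ++ [ suc m ]
range-∷ʳ m = ≡-trans (cong (map suc) (sym (upTo-∷ʳ m))) (map-++ suc (upTo m) [ m ])

length-range : ∀ m → length (range m) ≡ m
length-range m = ≡-trans (length-map suc (upTo m)) (length-upTo m)

∈-range⁺ : ∀ {m x} → 1 ≤ x → x ≤ m → x ∈ range m
∈-range⁺ {x = suc x} _ x≤m = ∈-map⁺ suc (∈-upTo⁺ x≤m)

∈-range⁻ : ∀ {m x} → x ∈ range m → ∃[ i ] (x ≡ suc i × i < m)
∈-range⁻ p with i , i∈ , refl ← ∈-map⁻ suc p = i , refl , ∈-upTo⁻ i∈

Unique-range : ∀ m → Unique (range m)
Unique-range m = Unique.map⁺ suc-injective (Unique.upTo⁺ m)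

perm-length : ∀ {m v} → IsPerm m v → length v ≡ m
perm-length {m} p = ≡-trans (↭-length p) (length-range m)

perm-unique : ∀ {m v} → IsPerm m v → Unique v
perm-unique {m} p = Permutationₛ.Unique-resp-↭ (setoid ℕ) (↭⇒↭ₛ (↭-sym p)) (Unique-range m)

perm-≤ : ∀ {m v x} → IsPerm m v → x ∈ v → x ≤ m
perm-≤ p x∈v with i , refl , i<m ← ∈-range⁻ (∈-resp-↭ p x∈v) = i<m

perm-≥1 : ∀ {m v x} → IsPerm m v → x ∈ v → 1 ≤ x
perm-≥1 p x∈v with i , refl , _ ← ∈-range⁻ (∈-resp-↭ p x∈v) = s≤s z≤n

perm-∈ : ∀ {m v x} → IsPerm m v → 1 ≤ x → x ≤ m → x ∈ v
perm-∈ p 1≤x x≤m = ∈-resp-↭ (↭-sym p) (∈-range⁺ 1≤x x≤m)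

countBelow-range : ∀ m i → i ≤ m → countBelow (range m) (suc i) ≡ i
countBelow-range zero    zero    _ = refl
countBelow-range (suc m) zero    _ = countBelow-none (All.tabulate (perm-≥1 {suc m} ↭-refl))
countBelow-range (suc m) (suc i) (s≤s i≤m) =
  ≡-trans (cong (λ w → countBelow w (2 + i)) (range-suc m))
          (cong suc (≡-trans (countBelow-map suc (range m) (suc i) (2 + i) λ _ → refl) (countBelow-range m i i≤m)))

red-perm : ∀ {m w} → IsPerm m w → red w ≡ w
red-perm {m} {w} p = map-id-local (All.tabulate λ x∈w → ranks x∈w)
  where
  ranks : ∀ {x} → x ∈ w → rank w x ≡ x
  ranks {x} x∈w with i , refl , i<m ← ∈-range⁻ (∈-resp-↭ p x∈w) =
    cong suc (≡-trans (countBelow-↭ (suc i) p) (countBelow-range m i (<⇒≤ i<m)))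

map-c-suc : ∀ i w → map (c (suc i)) (map suc w) ≡ map suc (map (c i) w)
map-c-suc i []      = refl
map-c-suc i (x ∷ w) = cong₂ _∷_ (c-suc i x) (map-c-suc i w)

-- `c i` leaves a gap at i, which the extra letter fills. In the successor case 0 is split off and
-- the rest is a shifted smaller instance.
upTo-insert : ∀ {m i} → i ≤ m → i ∷ map (c i) (upTo m) ↭ upTo (suc m)
upTo-insert {m}     {zero}  _         = ↭-reflexive (sym (upTo-suc m))
upTo-insert {suc m} {suc i} (s≤s i≤m) =
  trans (↭-reflexive (cong (λ l → suc i ∷ 0 ∷ l) shifted))
 (trans (swap (suc i) 0 refl)
 (trans (prep 0 (map⁺ suc (upTo-insert i≤m)))
        (↭-reflexive (sym (upTo-suc (suc m))))))
  where
  shifted : map (c (suc i)) (applyUpTo suc m) ≡ map suc (map (c i) (upTo m))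
  shifted = ≡-trans (cong (map (c (suc i))) (sym (map-upTo suc m))) (map-c-suc i (upTo m))

range-insert : ∀ {m i} → i ≤ m → suc i ∷ map (c (suc i)) (range m) ↭ range (suc m)
range-insert {m} {i} i≤m rewrite map-c-suc i (upTo m) = map⁺ suc (upTo-insert i≤m)

cons-perm⁺ : ∀ {m v i} → IsPerm m v → i ≤ m → IsPerm (suc m) (suc i ∷ map (c (suc i)) v)
cons-perm⁺ p i≤m = trans (prep _ (map⁺ _ p)) (range-insert i≤m)

-- The range can be rearranged to start with x, by `range-insert`; cancelling x on both sides leaves
-- w as a rearrangement of a `c x`-image, which is then pulled back.
cons-perm⁻ : ∀ {m x w} → IsPerm (suc m) (x ∷ w) →
             ∃[ v ] ∃[ i ] (IsPerm m v × i ≤ m × x ≡ suc i × w ≡ map (c x) v)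
cons-perm⁻ {m} p with i , refl , i<1+m ← ∈-range⁻ (∈-resp-↭ p (here refl))
  with v , w≡ , v↭ ← ↭-map-inv (c (suc i)) (drop-∷ (trans (range-insert (s≤s⁻¹ i<1+m)) (↭-sym p)))
  = v , i , ↭-sym v↭ , s≤s⁻¹ i<1+m , refl , w≡

ext-perm⁺ : ∀ {m v i} → IsPerm m v → i ≤ m → IsPerm (suc m) (ext v i)
ext-perm⁺ p i≤m = trans (↭-sym (∷↭∷ʳ _ _)) (cons-perm⁺ p i≤m)

ext-perm⁻ : ∀ {m σ} → IsPerm (suc m) σ → ∃[ v ] ∃[ i ] (IsPerm m v × i ≤ m × σ ≡ ext v i)
ext-perm⁻ {m} {σ} p with initLast σ
... | []       = contradiction (perm-length p) λ ()
... | w ∷ʳ′ b with v , i , pv , i≤m , refl , refl ← cons-perm⁻ (trans (∷↭∷ʳ b w) p) = v , i , pv , i≤m , refl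

ext-injective : ∀ {v v′ i i′} → ext v i ≡ ext v′ i′ → v ≡ v′ × i ≡ i′
ext-injective {v} {v′} {i} eq with eq₁ , refl ← ∷ʳ-injective (map (c (suc i)) v) _ eq =
  map-injective (c-injective (suc i)) eq₁ , refl

-- Closing the gap left by x reduces the tail, so a permutation is determined by its first letter
-- and its reduced tail. The edges entering a vertex are counted in this way.
red-tail-perm : ∀ {m x w} → IsPerm (suc m) (x ∷ w) → IsPerm m (red w) × w ≡ map (c x) (red w)
red-tail-perm p with v , i , pv , _ , refl , refl ← cons-perm⁻ p
  rewrite red-map-c (suc i) v | red-perm pv = pv , refl

next-perm : ∀ {m v i} → IsPerm m v → i ≤ m → IsPerm m (next v i)
next-perm {m} {v} {i} p i≤m = go (ext v i) (ext-perm⁺ p i≤m)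
  where
  go : ∀ σ → IsPerm (suc m) σ → IsPerm m (red (drop 1 σ))
  go []      q = contradiction (perm-length q) λ ()
  go (x ∷ w) q = proj₁ (red-tail-perm q)

pigeonhole : {xs ys : List A} → Unique xs → (∀ {x} → x ∈ xs → x ∈ ys) → length xs ≤ length ys
pigeonhole [] _ = z≤n
pigeonhole {xs = x ∷ xs} {ys} (x∉ ∷ u) f with as , bs , refl ← ∈-∃++ (f (here refl)) = begin
  suc (length xs)             ≤⟨ s≤s (pigeonhole u g) ⟩
  suc (length (as ++ bs))     ≡⟨ cong suc (length-++ as) ⟩
  suc (length as + length bs) ≡⟨ sym (+-suc _ _) ⟩
  length as + suc (length bs) ≡⟨ sym (length-++ as) ⟩
  length (as ++ x ∷ bs)       ∎
  where
  open ≤-Reasoning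
  g : ∀ {y} → y ∈ xs → y ∈ as ++ bs
  g {y} y∈ with ∈-++⁻ as (f (there y∈))
  ... | inj₁ q           = ∈-++⁺ˡ q
  ... | inj₂ (here refl) = contradiction refl (All.lookup x∉ y∈)
  ... | inj₂ (there q)   = ∈-++⁺ʳ as q

-- Each permutation is an extension of exactly one shorter permutation, so this list has no
-- repetitions and `m !` entries.
perms : ℕ → List (List ℕ)
perms zero    = [ [] ]
perms (suc m) = cartesianProductWith ext (perms m) (upTo (suc m))

perms-length : ∀ m → length (perms m) ≡ m !
perms-length zero    = refl
perms-length (suc m) = begin
  length (cartesianProductWith ext (perms m) (upTo (suc m))) ≡⟨ length-product (perms m) ⟩
  length (perms m) * length (upTo (suc m))  ≡⟨ cong₂ _*_ (perms-length m) (length-upTo (suc m)) ⟩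
  m ! * suc m                               ≡⟨ *-comm (m !) (suc m) ⟩
  suc m * m !                               ∎
  where
  open ≡-Reasoning
  length-product : ∀ vs → length (cartesianProductWith ext vs (upTo (suc m))) ≡ length vs * length (upTo (suc m))
  length-product []       = refl
  length-product (v ∷ vs) = ≡-trans (length-++ (map (ext v) (upTo (suc m))))
                                    (cong₂ _+_ (length-map (ext v) (upTo (suc m))) (length-product vs))

perms-unique : ∀ m → Unique (perms m)
perms-unique zero    = [] ∷ []
perms-unique (suc m) = Unique.cartesianProductWith⁺ ext ext-injective (perms-unique m) (Unique.upTo⁺ (suc m))

∈-perms⁺ : ∀ {m σ} → IsPerm m σ → σ ∈ perms m
∈-perms⁺ {zero} {[]}    p = here refl
∈-perms⁺ {zero} {x ∷ σ} p = contradiction (perm-length p) λ ()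
∈-perms⁺ {suc m} p with v , i , pv , i≤m , refl ← ext-perm⁻ p =
  ∈-cartesianProductWith⁺ ext (∈-perms⁺ pv) (∈-upTo⁺ (s≤s i≤m))

∈-perms⁻ : ∀ {m σ} → σ ∈ perms m → IsPerm m σ
∈-perms⁻ {zero}  (here refl) = refl
∈-perms⁻ {suc m} p with v , i , v∈ , i∈ , refl ← ∈-cartesianProductWith⁻ ext (perms m) (upTo (suc m)) p =
  ext-perm⁺ (∈-perms⁻ v∈) (s≤s⁻¹ (∈-upTo⁻ i∈))

-- Walks that use the edges at each vertex in order

indicator : {P : Set} → Dec P → ℕ
indicator P? = if does P? then 1 else 0

indicator-yes : {P : Set} (P? : Dec P) → P → indicator P? ≡ 1
indicator-yes (yes _) p = refl
indicator-yes (no ¬p) p = contradiction p ¬p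

indicator-no : {P : Set} (P? : Dec P) → ¬ P → indicator P? ≡ 0
indicator-no (yes p) ¬p = contradiction p ¬p
indicator-no (no _)  ¬p = refl

length-filter-∷ : {P : Pred A 0ℓ} (P? : Decidable P) (x : A) (xs : List A) →
                  length (filter P? (x ∷ xs)) ≡ indicator (P? x) + length (filter P? xs)
length-filter-∷ P? x xs with does (P? x)
... | true  = refl
... | false = refl

module Rotor {V : Set} (_≟_ : DecidableEquality V) (target : V → ℕ → V) (s : V) where

  Edge : Set
  Edge = V × ℕ

  leaves? : ∀ v → Decidable {A = Edge} (λ e → proj₁ e ≡ v)
  leaves? v e = proj₁ e ≟ v

  enters? : ∀ v → Decidable {A = Edge} (λ e → target (proj₁ e) (proj₂ e) ≡ v)
  enters? v e = target (proj₁ e) (proj₂ e) ≟ v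

  outs ins : V → List Edge → ℕ
  outs v es = length (filter (leaves? v) es)
  ins  v es = length (filter (enters? v) es)

  outs-same : ∀ v i es → outs v ((v , i) ∷ es) ≡ suc (outs v es)
  outs-same v i es = ≡-trans (length-filter-∷ (leaves? v) (v , i) es)
                             (cong (_+ outs v es) (indicator-yes (v ≟ v) refl))

  outs-other : ∀ {u v} i es → u ≢ v → outs v ((u , i) ∷ es) ≡ outs v es
  outs-other {u} {v} i es u≢v = ≡-trans (length-filter-∷ (leaves? v) (u , i) es)
                                        (cong (_+ outs v es) (indicator-no (u ≟ v) u≢v))

  -- A walk from s, most recent edge first, that leaves v for the (k+1)-st time along the edge labelled k
  -- and at most d v times in total.
  data Run (d : V → ℕ) : V → List Edge → Set where
    start : Run d s []
    step  : ∀ {v es} → Run d v es → outs v es < d v → Run d (target v (outs v es)) ((v , outs v es) ∷ es)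

  -- The chosen label depends on the history alone, and d only limits it. This makes the capped walk
  -- an initial segment of the full one.
  Run-mono : ∀ {d d′ v es} → (∀ v → d v ≤ d′ v) → Run d v es → Run d′ v es
  Run-mono d≤ start      = start
  Run-mono d≤ (step r p) = step (Run-mono d≤ r) (<-≤-trans p (d≤ _))

  module _ {d : V → ℕ} where

    balance : ∀ {v es} → Run d v es → ∀ x → ins x es + indicator (s ≟ x) ≡ outs x es + indicator (v ≟ x)
    balance start x = refl
    balance (step {v} {es} r p) x = begin
      ins x ((v , o) ∷ es) + δ s
        ≡⟨ cong (_+ δ s) (length-filter-∷ (enters? x) (v , o) es) ⟩
      (δ w + ins x es) + δ s   ≡⟨ +-assoc (δ w) (ins x es) (δ s) ⟩
      δ w + (ins x es + δ s)   ≡⟨ cong (δ w +_) (balance r x) ⟩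
      δ w + (outs x es + δ v)  ≡⟨ +-comm (δ w) _ ⟩
      (outs x es + δ v) + δ w  ≡⟨ cong (_+ δ w) (+-comm (outs x es) (δ v)) ⟩
      (δ v + outs x es) + δ w
        ≡⟨ cong (_+ δ w) (sym (length-filter-∷ (leaves? x) (v , o) es)) ⟩
      outs x ((v , o) ∷ es) + δ w ∎
      where
      open ≡-Reasoning
      o = outs v es
      w = target v o
      δ : V → ℕ
      δ y = indicator (y ≟ x)

    -- Labels at a vertex are spent in the order 0, 1, 2, ...; with the converse `∈-run⁺`, the
    -- number `outs u es` determines which edges at u have been used.
    ∈-run⁻ : ∀ {v es u i} → Run d v es → (u , i) ∈ es → i < outs u es
    ∈-run⁻ (step {v} {es} r p) (here refl) = ≤-reflexive (sym (outs-same v (outs v es) es))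
    ∈-run⁻ {u = u} (step {v} {es} r p) (there e∈) = ≤-trans (∈-run⁻ r e∈)
      (≤-trans (m≤n+m _ _) (≤-reflexive (sym (length-filter-∷ (leaves? u) (v , outs v es) es))))

    ∈-run⁺ : ∀ {v es u i} → Run d v es → i < outs u es → (u , i) ∈ es
    ∈-run⁺ {u = u} {i} (step {v} {es} r p) i< with v ≟ u
    ... | no _ = there (∈-run⁺ r i<)
    ... | yes refl with m≤n⇒m<n∨m≡n (s≤s⁻¹ i<)
    ...   | inj₁ i<o  = there (∈-run⁺ r i<o)
    ...   | inj₂ refl = here refl

    run-unique : ∀ {v es} → Run d v es → Unique es
    run-unique start      = []
    run-unique (step r p) = ¬Any⇒All¬ _ (λ e∈ → <-irrefl refl (∈-run⁻ r e∈)) ∷ run-unique r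

    outs≤d : ∀ {v es} → Run d v es → ∀ x → outs x es ≤ d x
    outs≤d start x = z≤n
    outs≤d (step {v} {es} r p) x with v ≟ x
    ... | yes refl = p
    ... | no _     = outs≤d r x

  data Reach (d : V → ℕ) : V → Set where
    here : Reach d s
    last : ∀ {v i} → suc i ≡ d v → Reach d (target v i) → Reach d v

  -- `OK` singles out the genuine vertices of V. The bounds on the number of edges are stated for
  -- lists without repetitions, which stand for finite edge sets.
  module Balanced (d : V → ℕ) (OK : V → Set) (OK-s : OK s)
    (OK-target : ∀ {v i} → OK v → i < d v → OK (target v i))
    (indegree : ∀ {v} → OK v → ∀ es → Unique es →
                (∀ {u i} → (u , i) ∈ es → OK u × i < d u × target u i ≡ v) → length es ≤ d v)
    (N : ℕ) (bounded : ∀ es → Unique es → (∀ {u i} → (u , i) ∈ es → OK u × i < d u) → length es ≤ N)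
    where

    run-OK : ∀ {v es} → Run d v es → OK v
    run-OK start      = OK-s
    run-OK (step r p) = OK-target (run-OK r) p

    run-edge : ∀ {v es u i} → Run d v es → (u , i) ∈ es → OK u × i < d u
    run-edge {u = u} r e∈ = source r e∈ , <-≤-trans (∈-run⁻ r e∈) (outs≤d r u)
      where
      source : ∀ {v es u i} → Run d v es → (u , i) ∈ es → OK u
      source (step r p) (here refl) = run-OK r
      source (step r p) (there e∈)  = source r e∈

    incoming : ∀ {v es} → Run d v es → ∀ {x u i} → (u , i) ∈ filter (enters? x) es →
               OK u × i < d u × target u i ≡ x
    incoming r {x} e∈ with e∈es , eq ← ∈-filter⁻ (enters? x) e∈ =
      proj₁ (run-edge r e∈es) , proj₂ (run-edge r e∈es) , eq

    -- Away from s the walk has entered its current vertex once more than it has left it.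
    not-stuck : ∀ {v es} → Run d v es → v ≢ s → outs v es < d v
    not-stuck {v} {es} r v≢s = begin-strict
      outs v es                        <⟨ n<1+n _ ⟩
      suc (outs v es)                  ≡⟨ +-comm 1 _ ⟩
      outs v es + 1                    ≡⟨ cong (outs v es +_) (sym (indicator-yes (v ≟ v) refl)) ⟩
      outs v es + indicator (v ≟ v)    ≡⟨ sym (balance r v) ⟩
      ins v es + indicator (s ≟ v)     ≡⟨ cong (ins v es +_) (indicator-no (s ≟ v) (v≢s ∘ sym)) ⟩
      ins v es + 0                     ≡⟨ +-identityʳ _ ⟩
      ins v es                         ≤⟨ indegree (run-OK r) _ (Unique.filter⁺ (enters? v) (run-unique r)) (incoming r) ⟩
      d v                              ∎
      where open ≤-Reasoning

    -- By `not-stuck` a walk that cannot go on is at s, and it must stop because it never repeats an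
    -- edge. The fuel k bounds how many edges are still missing to N.
    finish : ∀ {v es} → Run d v es → ∃[ es′ ] (Run d s (es′ ++ es) × outs s (es′ ++ es) ≡ d s)
    finish {es = es₀} r₀ = go N r₀ (m≤m+n N (length es₀))
      where
      go : ∀ k {v es} → Run d v es → N ≤ k + length es → ∃[ es′ ] (Run d s (es′ ++ es) × outs s (es′ ++ es) ≡ d s)
      go k {v} {es} r N≤ with outs v es <? d v
      go k {v} {es} r N≤ | no stuck with v ≟ s
      ... | yes refl = [] , r , ≤-antisym (outs≤d r v) (≮⇒≥ stuck)
      ... | no v≢s   = contradiction (not-stuck r v≢s) stuck
      -- With no fuel left all N edges are used, and one more step would exceed the bound.
      go zero {v} {es} r N≤ | yes p =
        contradiction (bounded _ (run-unique (step r p)) (run-edge (step r p))) (<⇒≱ (s≤s N≤))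
      go (suc k) {v} {es} r N≤ | yes p
        with es′ , r′ , eq ← go k (step r p) (≤-trans N≤ (≤-reflexive (sym (+-suc k (length es)))))
        rewrite sym (∷ʳ-++ es′ (v , outs v es) es) = es′ ∷ʳ (v , outs v es) , r′ , eq

    -- If v still had an unused edge, its last one would be unused; but that edge enters a vertex left,
    -- hence entered, as often as possible.
    saturated : ∀ {es v} → Run d s es → outs s es ≡ d s → OK v → Reach d v → outs v es ≡ d v
    saturated r eq OK-v here = eq
    saturated {es} {v} r eq OK-v (last {i = i} 1+i≡d reach) = ≤-antisym (outs≤d r v) (≮⇒≥ unused-absurd)
      where
      w = target v i
      i<d : i < d v
      i<d = ≤-reflexive 1+i≡d
      OK-w : OK w
      OK-w = OK-target OK-v i<d
      ins-w : ins w es ≡ d w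
      -- The walk is closed, so the two indicators in `balance` agree and cancel.
      ins-w = ≡-trans (+-cancelʳ-≡ _ _ _ (balance r w)) (saturated r eq OK-w reach)
      unused-absurd : ¬ outs v es < d v
      unused-absurd p = <-irrefl (cong suc ins-w) (s≤s (indegree OK-w ((v , i) ∷ filter (enters? w) es)
        (¬Any⇒All¬ _ fresh ∷ Unique.filter⁺ (enters? w) (run-unique r)) all-enter))
        where
        fresh : (v , i) ∉ filter (enters? w) es
        -- A used label i at v would give more than i departures, that is, all d v of them.
        fresh e∈ = <⇒≱ (∈-run⁻ r (proj₁ (∈-filter⁻ (enters? w) e∈))) (s≤s⁻¹ (≤-trans p (≤-reflexive (sym 1+i≡d))))
        all-enter : ∀ {u j} → (u , j) ∈ (v , i) ∷ filter (enters? w) es → OK u × j < d u × target u j ≡ w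
        all-enter (here refl) = OK-v , i<d , refl
        all-enter (there e∈)  = incoming r e∈

-- The graph of overlapping permutations

-- Decided by which of x and y is met first: y need not occur after x, and the value is false if x
-- equals y.
precedes : ℕ → ℕ → List ℕ → Bool
precedes x y [] = false
precedes x y (z ∷ p) with z ≟ y | z ≟ x
... | yes _ | _     = false
... | no _  | yes _ = true
... | no _  | no _  = precedes x y p

precedes-split⁺ : ∀ {x y} u {t} → x ≢ y → y ∉ u → precedes x y (u ++ x ∷ t) ≡ true
precedes-split⁺ {x} {y} [] x≢y y∉ with x ≟ y | x ≟ x
... | yes x≡y | _       = contradiction x≡y x≢y
... | no _    | yes _   = refl
... | no _    | no x≢x  = contradiction refl x≢x
precedes-split⁺ {x} {y} (z ∷ u) x≢y y∉ with z ≟ y | z ≟ x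
... | yes refl | _     = contradiction (here refl) y∉
... | no _     | yes _ = refl
... | no _     | no _  = precedes-split⁺ u x≢y (y∉ ∘ there)

precedes-split⁻ : ∀ {x y} p → precedes x y p ≡ true → ∃[ u ] ∃[ t ] (p ≡ u ++ x ∷ t × y ∉ u × x ≢ y)
precedes-split⁻ {x} {y} (z ∷ p) eq with z ≟ y | z ≟ x
... | no z≢y | yes refl = [] , p , refl , (λ ()) , z≢y
... | no z≢y | no _ with u , t , refl , y∉u , x≢y ← precedes-split⁻ p eq =
  z ∷ u , t , refl , (λ { (here refl) → z≢y refl ; (there y∈u) → y∉u y∈u }) , x≢y

precedes-false : ∀ {x y} u {t} → x ∉ u → precedes x y (u ++ y ∷ t) ≡ false
precedes-false {x} {y} [] x∉ with y ≟ y
... | yes _  = refl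
... | no y≢y = contradiction refl y≢y
precedes-false {x} {y} (z ∷ u) x∉ with z ≟ y | z ≟ x
... | yes _ | _        = refl
... | no _  | yes refl = contradiction (here refl) x∉
... | no _  | no _     = precedes-false u (x∉ ∘ there)

precedes-map : ∀ {f : ℕ → ℕ} → (∀ {x y} → f x ≡ f y → x ≡ y) → ∀ x y p →
               precedes (f x) (f y) (map f p) ≡ precedes x y p
precedes-map inj x y [] = refl
precedes-map {f} inj x y (z ∷ p) with f z ≟ f y | z ≟ y | f z ≟ f x | z ≟ x
... | yes _  | yes _  | _      | _      = refl
... | yes eq | no z≢y | _      | _      = contradiction (inj eq) z≢y
... | no neq | yes eq | _      | _      = contradiction (cong f eq) neq
... | no _   | no _   | yes _  | yes _  = refl
... | no _   | no _   | yes eq | no z≢x = contradiction (inj eq) z≢x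
... | no _   | no _   | no neq | yes eq = contradiction (cong f eq) neq
... | no _   | no _   | no _   | no _   = precedes-map inj x y p

precedes-++ˡ : ∀ {x y p} q → y ∈ p → precedes x y (p ++ q) ≡ precedes x y p
precedes-++ˡ {x} {y} {z ∷ p} q y∈ with z ≟ y | z ≟ x
... | yes _  | _     = refl
... | no _   | yes _ = refl
precedes-++ˡ {x} {y} {z ∷ p} q (here refl) | no z≢y | no _ = contradiction refl z≢y
precedes-++ˡ {x} {y} {z ∷ p} q (there y∈)  | no _   | no _ = precedes-++ˡ q y∈

precedes-∷ : ∀ {x y z} p → z ≢ y → z ≢ x → precedes x y (z ∷ p) ≡ precedes x y p
precedes-∷ {x} {y} {z} p z≢y z≢x with z ≟ y | z ≟ x
... | yes eq | _      = contradiction eq z≢y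
... | no _   | yes eq = contradiction eq z≢x
... | no _   | no _   = refl

Unique-map : ∀ {f : A → B} {xs} → (∀ {x y} → x ∈ xs → y ∈ xs → f x ≡ f y → x ≡ y) →
             Unique xs → Unique (map f xs)
Unique-map inj [] = []
Unique-map {f = f} {x ∷ xs} inj (x∉ ∷ u) =
  ¬Any⇒All¬ _ fresh ∷ Unique-map (λ p q → inj (there p) (there q)) u
  where
  fresh : f x ∉ map f xs
  fresh p with y , y∈ , eq ← ∈-map⁻ f p = All.lookup x∉ y∈ (inj (here refl) (there y∈) eq)

-- head letter, with junk value 0 on the empty word
first : List ℕ → ℕ
first []      = 0
first (x ∷ _) = x

up : ℕ → ℕ → List ℕ
up M zero    = []
up M (suc k) = M ∷ up (suc M) k

up-∷ʳ : ∀ M k → up M (suc k) ≡ up M k ++ [ M + k ]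
up-∷ʳ M zero    = cong [_] (sym (+-identityʳ M))
up-∷ʳ M (suc k) = cong (M ∷_) (≡-trans (up-∷ʳ (suc M) k) (cong (λ x → up (suc M) k ++ [ x ]) (sym (+-suc M k))))

up-bounded : ∀ M k → All (λ x → M ≤ x × x < M + k) (up M k)
up-bounded M zero    = []
up-bounded M (suc k) = (≤-refl , m<m+n M z<s) ∷
  All.map (λ {x} (p , q) → <⇒≤ p , subst (x <_) (sym (+-suc M k)) q) (up-bounded (suc M) k)

up-sorted : ∀ M k → AllPairs _<_ (up M k)
up-sorted M zero    = []
up-sorted M (suc k) = All.map proj₁ (up-bounded (suc M) k) ∷ up-sorted (suc M) k

length-up : ∀ M k → length (up M k) ≡ k
length-up M zero    = refl
length-up M (suc k) = cong suc (length-up (suc M) k)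

red-sorted : ∀ {w} → AllPairs _<_ w → red w ≡ range (length w)
red-sorted [] = refl
red-sorted {x ∷ w} (x< ∷ sorted) = begin
  rank (x ∷ w) x ∷ map (rank (x ∷ w)) w
    ≡⟨ cong₂ _∷_ (cong suc (countBelow-none (≤-refl ∷ All.map <⇒≤ x<)))
                 (map-cong-local (All.map (λ {y} x<y → cong (λ b → suc (if b then rank w y else countBelow w y)) (<ᵇ-true x<y))
                                          x<)) ⟩
  1 ∷ map (suc ∘ rank w) w      ≡⟨ cong (1 ∷_) (map-∘ w) ⟩
  1 ∷ map suc (red w)           ≡⟨ cong (λ v → 1 ∷ map suc v) (red-sorted sorted) ⟩
  1 ∷ map suc (range (length w)) ≡⟨ sym (range-suc (length w)) ⟩
  range (suc (length w))        ∎
  where open ≡-Reasoning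

maxL-bound : ∀ w → All (_< suc (maxL w)) w
maxL-bound []      = []
maxL-bound (x ∷ w) = s≤s (m≤m⊔n x (maxL w)) ∷ All.map (λ p → <-≤-trans p (s≤s (m≤n⊔m x (maxL w)))) (maxL-bound w)

module Graph (m : ℕ) (2≤m : 2 ≤ m) where

  s : List ℕ
  s = range m

  open Rotor (≡-dec _≟_) next s public

  m≢1 : m ≢ 1
  m≢1 refl = contradiction 2≤m λ { (s≤s ()) }

  1≤m : 1 ≤ m
  1≤m = <⇒≤ 2≤m

  1+m≢1 : suc m ≢ 1
  1+m≢1 = m≢1 ∘ λ { refl → contradiction 1≤m λ () }

  full cap : List ℕ → ℕ
  full _ = suc m
  cap v  = if precedes m 1 v then m else 1

  cap≤m : ∀ v → cap v ≤ m
  cap≤m v with precedes m 1 v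
  ... | true  = ≤-refl
  ... | false = 1≤m

  cap≤full : ∀ v → cap v ≤ full v
  cap≤full v = m≤n⇒m≤1+n (cap≤m v)

  cap-pos : ∀ v → 0 < cap v
  cap-pos v with precedes m 1 v
  ... | true  = 1≤m
  ... | false = z<s

  cap-true : ∀ v → precedes m 1 v ≡ true → cap v ≡ m
  cap-true v eq rewrite eq = refl

  cap-false : ∀ v → precedes m 1 v ≡ false → cap v ≡ 1
  cap-false v eq rewrite eq = refl

  -- Edges within the cap, leaving and entering a vertex

  c-1 : ∀ {i} → 0 < i → c (suc i) 1 ≡ 1
  c-1 0<i = c-below (s≤s 0<i)

  precedes-middle : ∀ {i} v → 0 < i → i < m → precedes (suc m) 1 (map (c (suc i)) v) ≡ precedes m 1 v
  precedes-middle {i} v 0<i i<m = ≡-trans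
    (cong₂ (λ x y → precedes x y (map (c (suc i)) v)) (sym (c-above i<m)) (sym (c-1 0<i)))
    (precedes-map (c-injective (suc i)) m 1 v)

  -- The new 1 comes last, hence after the letter m, which has become m + 1.
  ext-min : ∀ {v} → IsPerm m v → precedes (suc m) 1 (ext v 0) ≡ true
  ext-min {v} p with u , t , eq ← ∈-∃++ (∈-map⁺ (c 1) (perm-∈ p 1≤m ≤-refl)) = begin
    precedes (suc m) 1 (map (c 1) v ++ [ 1 ])          ≡⟨ cong (λ w → precedes (suc m) 1 (w ++ [ 1 ])) eq ⟩
    precedes (suc m) 1 ((u ++ c 1 m ∷ t) ++ [ 1 ])     ≡⟨ cong (precedes (suc m) 1) (++-assoc u _ _) ⟩
    precedes (suc m) 1 (u ++ c 1 m ∷ t ++ [ 1 ])       ≡⟨ cong (λ x → precedes (suc m) 1 (u ++ x ∷ t ++ [ 1 ])) (c-above 1≤m) ⟩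
    precedes (suc m) 1 (u ++ suc m ∷ t ++ [ 1 ])       ≡⟨ precedes-split⁺ u 1+m≢1 1∉u ⟩
    true                                               ∎
    where
    open ≡-Reasoning
    1∉u : 1 ∉ u
    1∉u 1∈u with x , _ , 1≡ ← ∈-map⁻ (c 1) (subst (1 ∈_) (sym eq) (∈-++⁺ˡ 1∈u)) = c-≢ 1 x (sym 1≡)

  ext-max : ∀ {v} → IsPerm m v → precedes (suc m) 1 (ext v m) ≡ false
  ext-max {v} p with u , t , eq ← ∈-∃++ (∈-map⁺ (c (suc m)) (perm-∈ p ≤-refl 1≤m)) = begin
    precedes (suc m) 1 (map (c (suc m)) v ++ [ suc m ])  ≡⟨ cong (λ w → precedes (suc m) 1 (w ++ [ suc m ])) eq ⟩
    precedes (suc m) 1 ((u ++ c (suc m) 1 ∷ t) ++ [ suc m ]) ≡⟨ cong (precedes (suc m) 1) (++-assoc u _ _) ⟩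
    precedes (suc m) 1 (u ++ c (suc m) 1 ∷ t ++ [ suc m ])
      ≡⟨ cong (λ x → precedes (suc m) 1 (u ++ x ∷ t ++ [ suc m ])) (c-1 1≤m) ⟩
    precedes (suc m) 1 (u ++ 1 ∷ t ++ [ suc m ])         ≡⟨ precedes-false u n∉u ⟩
    false                                                ∎
    where
    open ≡-Reasoning
    n∉u : suc m ∉ u
    n∉u n∈u with x , _ , n≡ ← ∈-map⁻ (c (suc m)) (subst (suc m ∈_) (sym eq) (∈-++⁺ˡ n∈u)) = c-≢ (suc m) x (sym n≡)

  -- An intermediate label turns the maximum m into m + 1, leaves 1 alone and appends a letter that
  -- is neither, so the order of the extremes is that in v.
  ext-middle : ∀ {v i} → IsPerm m v → 0 < i → i < m → precedes (suc m) 1 (ext v i) ≡ precedes m 1 v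
  ext-middle {v} {i} p 0<i i<m = ≡-trans
    (precedes-++ˡ [ suc i ] (subst (_∈ map (c (suc i)) v) (c-1 0<i) (∈-map⁺ (c (suc i)) (perm-∈ p ≤-refl 1≤m))))
    (precedes-middle v 0<i i<m)

  -- Label 0 always puts n before 1, label m never does, and the labels between follow v. Hence
  -- these permutations form an initial block of labels, whose length is the cap; `ext-cap⁻` is the
  -- converse.
  ext-cap⁺ : ∀ {v i} → IsPerm m v → i < cap v → precedes (suc m) 1 (ext v i) ≡ true
  ext-cap⁺ {v} {zero}  p i<cap = ext-min p
  ext-cap⁺ {v} {suc i} p i<cap with precedes m 1 v in eq
  ... | true  = ≡-trans (ext-middle p z<s i<cap) eq
  ... | false = contradiction i<cap λ { (s≤s ()) }

  ext-cap⁻ : ∀ {v i} → IsPerm m v → i ≤ m → precedes (suc m) 1 (ext v i) ≡ true → i < cap v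
  ext-cap⁻ {v} {zero}  p i≤m eq = cap-pos v
  ext-cap⁻ {v} {suc i} p i≤m eq with m≤n⇒m<n∨m≡n i≤m
  ... | inj₂ refl = contradiction (≡-trans (sym eq) (ext-max p)) λ ()
  ... | inj₁ i<m  = ≤-trans i<m (≤-reflexive (sym (cap-true v (≡-trans (sym (ext-middle p z<s i<m)) eq))))

  ext-first : ∀ {v i} → IsPerm m v → i ≤ m →
              ∃[ j ] (j ≤ m × ext v i ≡ suc j ∷ map (c (suc j)) (next v i))
  ext-first {v} {i} p i≤m = go (ext v i) (ext-perm⁺ p i≤m)
    where
    go : ∀ σ → IsPerm (suc m) σ → ∃[ j ] (j ≤ m × σ ≡ suc j ∷ map (c (suc j)) (red (drop 1 σ)))
    go []      q = contradiction (perm-length q) λ ()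
    go (x ∷ w) q with v , j , pv , j≤m , refl , refl ← cons-perm⁻ q = j , j≤m , cong (suc j ∷_) (proj₂ (red-tail-perm q))

  -- A first letter 1 would stand before n. The letters 2, ..., n remain, m in number as the cap of
  -- v.
  first-true : ∀ {v j} → j ≤ m → precedes (suc m) 1 (suc j ∷ map (c (suc j)) v) ≡ true →
               precedes m 1 v ≡ true → suc j ∈ map suc (range m)
  first-true {v} {zero}  j≤m eq D = contradiction (≡-trans (sym eq) (precedes-false {suc m} {1} [] {map (c 1) v} λ ())) λ ()
  first-true {v} {suc j} j≤m eq D = ∈-map⁺ suc (∈-range⁺ z<s j≤m)

  -- A first letter 1 would precede n, and an intermediate one would leave the extremes in the order
  -- they have in v. Only n remains, matching the cap 1.
  first-false : ∀ {v j} → j ≤ m → precedes (suc m) 1 (suc j ∷ map (c (suc j)) v) ≡ true →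
                precedes m 1 v ≡ false → j ≡ m
  first-false {v} {zero} j≤m eq D = contradiction (≡-trans (sym eq) (precedes-false {suc m} {1} [] {map (c 1) v} λ ())) λ ()
  first-false {v} {suc j} j≤m eq D with m≤n⇒m<n∨m≡n j≤m
  ... | inj₂ j≡m = j≡m
  ... | inj₁ j<m = contradiction (≡-trans (sym eq) (≡-trans (precedes-∷ {suc m} {1} (map (c (2 + j)) v) (λ ()) (<⇒≢ (s≤s j<m)))
                                 (≡-trans (precedes-middle v z<s j<m) D))) λ ()

  firstLetter : Edge → ℕ
  firstLetter (u , i) = first (ext u i)

  -- Edges into v share their reduced tail and are told apart by their first letters, which are
  -- drawn from L.
  entering-bound : ∀ {v} (L : List ℕ) es → Unique es →
    (∀ {u i} → (u , i) ∈ es → IsPerm m u × i ≤ m × next u i ≡ v × first (ext u i) ∈ L) → length es ≤ length L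
  entering-bound {v} L es u! h = subst (_≤ length L) (length-map firstLetter es) (pigeonhole (Unique-map inj u!) sub)
    where
    shape : ∀ {u i} → (u , i) ∈ es → ext u i ≡ firstLetter (u , i) ∷ map (c (firstLetter (u , i))) v
    shape e∈ with pu , i≤m , eq , _ ← h e∈ with j , _ , σ≡ ← ext-first pu i≤m
      rewrite eq | σ≡ = refl
    inj : ∀ {e f} → e ∈ es → f ∈ es → firstLetter e ≡ firstLetter f → e ≡ f
    inj {u , i} {u′ , i′} e∈ f∈ eq with refl , refl ←
      ext-injective {u} {u′} {i} {i′} (≡-trans (shape e∈) (≡-trans (cong (λ x → x ∷ map (c x) v) eq) (sym (shape f∈)))) = refl
    sub : ∀ {x} → x ∈ map firstLetter es → x ∈ L
    sub p with (u , i) , e∈ , refl ← ∈-map⁻ firstLetter p = proj₂ (proj₂ (proj₂ (h e∈)))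

  indegree-full : ∀ {v} → IsPerm m v → ∀ es → Unique es →
    (∀ {u i} → (u , i) ∈ es → IsPerm m u × i < full u × next u i ≡ v) → length es ≤ full v
  indegree-full pv es u! h = subst (length es ≤_) (length-range (suc m)) (entering-bound (range (suc m)) es u! h′)
    where
    h′ : ∀ {u i} → (u , i) ∈ es → IsPerm m u × i ≤ m × next u i ≡ _ × first (ext u i) ∈ range (suc m)
    h′ e∈ with pu , i<n , eq ← h e∈ with j , j≤m , σ≡ ← ext-first pu (s≤s⁻¹ i<n) =
      pu , s≤s⁻¹ i<n , eq , subst (λ σ → first σ ∈ range (suc m)) (sym σ≡) (∈-range⁺ z<s (s≤s j≤m))

  capLetters : List ℕ → List ℕ
  capLetters v = if precedes m 1 v then map suc (range m) else [ suc m ]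

  length-capLetters : ∀ v → length (capLetters v) ≡ cap v
  length-capLetters v with precedes m 1 v
  ... | true  = ≡-trans (length-map suc (range m)) (length-range m)
  ... | false = refl

  indegree-cap : ∀ {v} → IsPerm m v → ∀ es → Unique es →
    (∀ {u i} → (u , i) ∈ es → IsPerm m u × i < cap u × next u i ≡ v) → length es ≤ cap v
  indegree-cap {v} pv es u! h = subst (length es ≤_) (length-capLetters v) (entering-bound (capLetters v) es u! h′)
    where
    letter : ∀ {j} → j ≤ m → precedes (suc m) 1 (suc j ∷ map (c (suc j)) v) ≡ true → suc j ∈ capLetters v
    letter j≤m eq with precedes m 1 v in D
    ... | true  = first-true j≤m eq D
    ... | false = here (cong suc (first-false j≤m eq D))
    h′ : ∀ {u i} → (u , i) ∈ es → IsPerm m u × i ≤ m × next u i ≡ v × first (ext u i) ∈ capLetters v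
    h′ {u} {i} e∈ with pu , i<cap , refl ← h e∈
      with j , j≤m , σ≡ ← ext-first pu (<⇒≤ (≤-trans i<cap (cap≤m u))) =
      pu , <⇒≤ (≤-trans i<cap (cap≤m u)) , refl ,
      subst (λ σ → first σ ∈ capLetters v) (sym σ≡)
        (letter j≤m (≡-trans (cong (precedes (suc m) 1) (sym σ≡)) (ext-cap⁺ pu i<cap)))

  perm-of : Edge → List ℕ
  perm-of (u , i) = ext u i

  perm-of-injective : ∀ {e f} → perm-of e ≡ perm-of f → e ≡ f
  perm-of-injective {u , i} {u′ , i′} eq with refl , refl ← ext-injective {u} {u′} {i} {i′} eq = refl

  edge-bound : ∀ es → Unique es → (∀ {u i} → (u , i) ∈ es → IsPerm m u × i < full u) → length es ≤ suc m !
  edge-bound es u! h = subst₂ _≤_ (length-map perm-of es) (perms-length (suc m))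
    (pigeonhole (Unique.map⁺ perm-of-injective u!) sub)
    where
    sub : ∀ {σ} → σ ∈ map perm-of es → σ ∈ perms (suc m)
    sub p with (u , i) , e∈ , refl ← ∈-map⁻ perm-of p with pu , i<n ← h e∈ = ∈-perms⁺ (ext-perm⁺ pu (s≤s⁻¹ i<n))

  -- The full and the capped walk, and their paths of last edges

  module Full = Balanced full (IsPerm m) ↭-refl (λ p i<n → next-perm p (s≤s⁻¹ i<n)) indegree-full (suc m !) edge-bound

  module Cap = Balanced cap (IsPerm m) ↭-refl (λ {v} p i<cap → next-perm p (<⇒≤ (≤-trans i<cap (cap≤m v)))) indegree-cap
    (suc m !) (λ es u! h → edge-bound es u! λ {u} e∈ → proj₁ (h e∈) , <-≤-trans (proj₂ (h e∈)) (cap≤full u))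

  -- Lets the paths below be followed on unreduced windows, with the appended letter b given by its
  -- value instead of its label.
  reach-by : ∀ {d} w b → suc (countBelow w b) ≡ d (red w) →
             Reach d (red (drop 1 (map (c b) w ++ [ b ]))) → Reach d (red w)
  reach-by {d} w b eq r = last eq (subst (Reach d) (sym (next-red w b)) r)

  reach-sorted : ∀ {d w} → AllPairs _<_ w → length w ≡ m → Reach d (red w)
  reach-sorted {d} sorted len = subst (Reach d) (sym (≡-trans (red-sorted sorted) (cong range len))) here

  -- Appending new maxima m times yields an increasing window.
  reach-full′ : ∀ u t → length (u ++ t) ≡ m → AllPairs _<_ t → Reach full (red (u ++ t))
  reach-full′ []      t len sorted = reach-sorted sorted len
  reach-full′ (x ∷ u) t len sorted = reach-by w b
    (cong suc (≡-trans (countBelow-all (maxL-bound w)) len))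
    (subst (Reach full ∘ red) (sym next≡)
      (reach-full′ u (t ++ [ b ]) len′
        (AllPairs-++⁺ sorted ([] ∷ []) (All.map (λ p → p ∷ []) (++⁻ʳ (x ∷ u) (maxL-bound w))))))
    where
    w = x ∷ u ++ t
    b = suc (maxL w)
    next≡ : drop 1 (map (c b) w ++ [ b ]) ≡ u ++ t ++ [ b ]
    next≡ = ≡-trans (cong (λ l → drop 1 (l ++ [ b ])) (map-c-below (maxL-bound w))) (++-assoc u t [ b ])
    len′ : length (u ++ t ++ [ b ]) ≡ m
    len′ = ≡-trans (cong length (sym (++-assoc u t [ b ])))
          (≡-trans (length-++ (u ++ t)) (≡-trans (+-comm _ 1) len))

  reach-full : ∀ {v} → IsPerm m v → Reach full v
  reach-full {v} p = subst (Reach full) (≡-trans (cong red (++-identityʳ v)) (red-perm p))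
    (reach-full′ v [] (≡-trans (cong length (++-identityʳ v)) (perm-length p)) [])

  -- While the maximum M precedes the minimum, the last edge within the cap appends a letter just below M.
  descend : ∀ u M t z → length (u ++ M ∷ t) ≡ m → All (_< M) u → All (_< M) t → z ∈ t → All (z <_) u →
            Reach cap (red (t ++ up M (suc (length u)))) → Reach cap (red (u ++ M ∷ t))
  descend u M t z len u<M t<M z∈t z<u r = reach-by w M (≡-trans rank-M (sym (cap-true (red w) D))) (continue u len u<M z<u r)
    where
    w = u ++ M ∷ t
    rank-M : rank w M ≡ m
    rank-M = begin
      suc (countBelow w M)                               ≡⟨ cong suc (countBelow-++ u (M ∷ t) M) ⟩
      suc (countBelow u M + countBelow (M ∷ t) M)
        ≡⟨ cong₂ (λ i b → suc (i + (if b then suc (countBelow t M) else countBelow t M)))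
                 (countBelow-all u<M) (<ᵇ-false (≤-refl {M})) ⟩
      suc (length u + countBelow t M)                    ≡⟨ cong (λ k → suc (length u + k)) (countBelow-all t<M) ⟩
      suc (length u + length t)                          ≡⟨ sym (+-suc (length u) (length t)) ⟩
      length u + length (M ∷ t)                          ≡⟨ sym (length-++ u) ⟩
      length w                                           ≡⟨ len ⟩
      m                                                  ∎
      where open ≡-Reasoning
    -- The letter z of t lies below all of u, so no letter of u has rank 1.
    1∉ : 1 ∉ map (rank w) u
    1∉ p with x , x∈u , eq ← ∈-map⁻ (rank w) p =
      contradiction (countBelow-strict (∈-++⁺ʳ u (there z∈t)) (All.lookup z<u x∈u))
        λ lt → contradiction (subst (countBelow w z <_) (sym (suc-injective eq)) lt) λ ()
    D : precedes m 1 (red w) ≡ true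
    D = ≡-trans (cong (precedes m 1) (≡-trans (map-++ (rank w) u (M ∷ t))
                                         (cong (λ k → map (rank w) u ++ k ∷ map (rank w) t) rank-M)))
                (precedes-split⁺ (map (rank w) u) m≢1 1∉)
    shifted : ∀ u′ → All (_< M) u′ → map (c M) (u′ ++ M ∷ t) ≡ u′ ++ suc M ∷ t
    shifted u′ u′< = ≡-trans (map-++ (c M) u′ (M ∷ t))
      (cong₂ _++_ (map-c-below u′<) (cong₂ _∷_ (c-above (≤-refl {M})) (map-c-below t<M)))
    continue : ∀ u → length (u ++ M ∷ t) ≡ m → All (_< M) u → All (z <_) u →
               Reach cap (red (t ++ up M (suc (length u)))) →
               Reach cap (red (drop 1 (map (c M) (u ++ M ∷ t) ++ [ M ])))
    appended : ∀ u → All (_< M) u → drop 1 (u ++ suc M ∷ t ++ [ M ]) ≡ drop 1 (map (c M) (u ++ M ∷ t) ++ [ M ])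
    appended u u<M = cong (drop 1) (≡-trans (sym (++-assoc u (suc M ∷ t) [ M ])) (cong (_++ [ M ]) (sym (shifted u u<M))))
    continue [] len _ _ r = subst (Reach cap ∘ red) (appended [] []) r
    continue (x ∷ u) len (x<M ∷ u<M) (_ ∷ z<u) r = subst (Reach cap ∘ red) (appended (x ∷ u) (x<M ∷ u<M))
     -- The first letter of u is gone, the old maximum has become `suc M`, and the appended M joins
     -- t. The letters appended over the whole descent are M, M + 1, and so on.
     (descend u (suc M) (t ++ [ M ]) z len′ (All.map m<n⇒m<1+n u<M)
        (All-++⁺ (All.map m<n⇒m<1+n t<M) (≤-refl ∷ [])) (∈-++⁺ˡ z∈t) z<u
        (subst (Reach cap ∘ red) (sym (++-assoc t [ M ] _)) r))
      where
      len′ : length (u ++ suc M ∷ t ++ [ M ]) ≡ m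
      len′ = begin
        length (u ++ suc M ∷ t ++ [ M ])     ≡⟨ cong length (sym (++-assoc u (suc M ∷ t) [ M ])) ⟩
        length ((u ++ suc M ∷ t) ++ [ M ])   ≡⟨ length-++ (u ++ suc M ∷ t) ⟩
        length (u ++ suc M ∷ t) + 1          ≡⟨ +-comm _ 1 ⟩
        suc (length (u ++ suc M ∷ t))        ≡⟨ cong suc (≡-trans (length-++ u) (sym (length-++ u))) ⟩
        suc (length (u ++ M ∷ t))            ≡⟨ len ⟩
        m                                    ∎
        where open ≡-Reasoning

  -- Once the maximum is last, appending a minimum and descending again leads to the increasing word.
  reach-max-last : ∀ w M z → length (w ++ [ M ]) ≡ m → All (_< M) w → z ∈ w → All (z ≤_) w →
                   Reach cap (red (w ++ [ M ]))
  -- Label 0 is the only one allowed here. The appended minimum is taken to be 0, and `c 0` raises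
  -- every other letter by one.
  reach-max-last w₀@(y ∷ w) M z len w<M@(_ ∷ w<M′) z∈ z≤ = reach-by W 0
    (≡-trans (cong suc (countBelow-none {W} (All.tabulate λ _ → z≤n))) (sym (cap-false (red W) asc)))
    (subst (Reach cap ∘ red) (sym next≡)
      (descend (map suc w) (suc M) [ 0 ] 0 len′
        (All-map⁺ (All.map s≤s w<M′)) (z<s ∷ []) (here refl) (All-map⁺ (All.tabulate λ _ → z<s))
        -- The descent has left 0 followed by consecutive letters from M + 1 on.
        (reach-sorted (All.map (≤-trans z<s ∘ proj₁) (up-bounded (suc M) _) ∷ up-sorted (suc M) _)
          (≡-trans (cong suc (length-up (suc M) _)) (≡-trans (sym (+-comm _ 2))
                                                     (≡-trans (sym (length-++ (map suc w))) len′))))))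
    where
    W = w₀ ++ [ M ]
    next≡ : drop 1 (map (c 0) W ++ [ 0 ]) ≡ map suc w ++ suc M ∷ [ 0 ]
    next≡ = ≡-trans (cong (_++ [ 0 ]) (map-++ suc w [ M ])) (++-assoc (map suc w) [ suc M ] [ 0 ])
    len′ : length (map suc w ++ suc M ∷ [ 0 ]) ≡ m
    len′ = begin
      length (map suc w ++ suc M ∷ [ 0 ])  ≡⟨ length-++ (map suc w) ⟩
      length (map suc w) + 2               ≡⟨ cong (_+ 2) (length-map suc w) ⟩
      length w + 2                         ≡⟨ +-suc (length w) 1 ⟩
      suc (length w + 1)                   ≡⟨ cong suc (sym (length-++ w)) ⟩
      length W                             ≡⟨ len ⟩
      m                                    ∎
      where open ≡-Reasoning
    rank-z : rank W z ≡ 1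
    rank-z = cong suc (countBelow-none (All-++⁺ z≤ (<⇒≤ (All.lookup w<M z∈) ∷ [])))
    rank-M : rank W M ≡ m
    rank-M = begin
      suc (countBelow W M)                            ≡⟨ cong suc (countBelow-++ w₀ [ M ] M) ⟩
      suc (countBelow w₀ M + countBelow [ M ] M)
        ≡⟨ cong₂ (λ i j → suc (i + j)) (countBelow-all w<M) (countBelow-none (≤-refl {M} ∷ [])) ⟩
      suc (length w₀ + 0)                             ≡⟨ sym (+-suc (length w₀) 0) ⟩
      length w₀ + 1                                   ≡⟨ sym (length-++ w₀) ⟩
      length W                                        ≡⟨ len ⟩
      m                                               ∎
      where open ≡-Reasoning
    m∉ : m ∉ map (rank W) w₀
    m∉ p with x , x∈ , eq ← ∈-map⁻ (rank W) p =
      <-irrefl (≡-trans (sym eq) (sym rank-M)) (s<s (countBelow-strict (∈-++⁺ˡ x∈) (All.lookup w<M x∈)))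
    asc : precedes m 1 (red W) ≡ false
    asc with u , t , eq ← ∈-∃++ (subst (_∈ map (rank W) w₀) rank-z (∈-map⁺ (rank W) z∈)) =
      ≡-trans (cong (precedes m 1) (≡-trans (map-++ (rank W) w₀ [ M ]) (≡-trans (cong (_++ [ rank W M ]) eq) (++-assoc u _ _))))
              (precedes-false u λ m∈u → m∉ (subst (m ∈_) (sym eq) (∈-++⁺ˡ m∈u)))

  -- Write v as u m t with 1 in t. Descending once for each letter of u and once for m itself gives
  -- t followed by m, ..., m + k, whose maximum is last, so that `reach-max-last` applies.
  reach-descending : ∀ {v} → IsPerm m v → precedes m 1 v ≡ true → Reach cap v
  reach-descending {v} p D with u , t , refl , 1∉u , _ ← precedes-split⁻ v D =
    subst (Reach cap) (red-perm p)
      (descend u m t 1 (perm-length p) (All.map proj₂ u-bounds) t<m 1∈t (All.map proj₁ u-bounds)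
        (subst (Reach cap ∘ red) (≡-trans (++-assoc t _ _) (cong (t ++_) (sym (up-∷ʳ m k))))
          (reach-max-last (t ++ up m k) (m + k) 1 len
            (All-++⁺ (All.map (λ q → <-≤-trans q (m≤m+n m k)) t<m) (All.map proj₂ (up-bounded m k)))
            (∈-++⁺ˡ 1∈t)
            (All-++⁺ (All.tabulate λ x∈t → perm-≥1 p (∈-++⁺ʳ u (there x∈t)))
                     (All.map (≤-trans 1≤m ∘ proj₁) (up-bounded m k))))))
    where
    k = length u
    rest : All (m ≢_) (u ++ t)
    rest with x∉ ∷ _ ← perm-unique (trans (↭-sym (shift m u t)) p) = x∉
    1∈t : 1 ∈ t
    1∈t with ∈-++⁻ u (perm-∈ p ≤-refl 1≤m)
    ... | inj₁ q         = contradiction q 1∉u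
    ... | inj₂ (here eq) = contradiction (sym eq) m≢1
    ... | inj₂ (there q) = q
    t<m : All (_< m) t
    t<m = All.tabulate λ x∈t → ≤∧≢⇒< (perm-≤ p (∈-++⁺ʳ u (there x∈t))) (All.lookup rest (∈-++⁺ʳ u x∈t) ∘ sym)
    u-bounds : All (λ x → 1 < x × x < m) u
    u-bounds = All.tabulate λ {x} x∈u →
      ≤∧≢⇒< (perm-≥1 p (∈-++⁺ˡ x∈u)) (λ eq → 1∉u (subst (_∈ u) (sym eq) x∈u)) ,
      ≤∧≢⇒< (perm-≤ p (∈-++⁺ˡ x∈u)) (All.lookup rest (∈-++⁺ˡ x∈u) ∘ sym)
    len : length ((t ++ up m k) ++ [ m + k ]) ≡ m
    len = begin
      length ((t ++ up m k) ++ [ m + k ])  ≡⟨ length-++ (t ++ up m k) ⟩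
      length (t ++ up m k) + 1             ≡⟨ cong (_+ 1) (≡-trans (length-++ t) (cong (length t +_) (length-up m k))) ⟩
      (length t + k) + 1                   ≡⟨ ≡-trans (+-comm _ 1) (cong suc (+-comm (length t) k)) ⟩
      suc (k + length t)                   ≡⟨ sym (+-suc k (length t)) ⟩
      k + length (m ∷ t)                   ≡⟨ sym (length-++ u) ⟩
      length (u ++ m ∷ t)                  ≡⟨ perm-length p ⟩
      m                                    ∎
      where open ≡-Reasoning

  -- If the maximum of v does not precede its minimum, the only allowed edge has label 0 and leads
  -- to a vertex where it does: otherwise `first-false` makes n the first letter of this edge, so v
  -- would start with its maximum.
  reach-cap : ∀ {v} → IsPerm m v → Reach cap v
  reach-cap {v} p with precedes m 1 v in eq
  ... | true  = reach-descending p eq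
  ... | false with precedes m 1 (next v 0) in eq′
  ...   | true  = last (sym (cap-false v eq)) (reach-descending (next-perm p z≤n) eq′)
  ...   | false with j , j≤m , σ≡ ← ext-first {v} {0} p z≤n
    with refl ← first-false {next v 0} j≤m (≡-trans (cong (precedes (suc m) 1) (sym σ≡)) (ext-min p)) eq′ =
    contradiction (≡-trans (sym eq) (max-first v p σ≡)) λ ()
    where
    max-first : ∀ v {t} → IsPerm m v → ext v 0 ≡ suc m ∷ t → precedes m 1 v ≡ true
    max-first []      q _  = contradiction (perm-length q) λ len → contradiction (subst (1 ≤_) (sym len) 1≤m) λ ()
    max-first (x ∷ v) q eq
      with refl ← suc-injective (≡-trans (sym (c-above (perm-≥1 q (here refl)))) (cong first eq)) =
      precedes-split⁺ [] m≢1 λ ()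

-- The greedy algorithm as a walk

-- The local functions of ithSmallest and greedyStep cannot be named from outside Defs, but they are
-- the only solutions of the metas below: the with-abstractions turn the list argument into a variable
-- distinct from the other arguments.
mutual
  withRank : List ℕ → ℕ → List ℕ → List ℕ
  withRank = _

  withRank-spec : ∀ x xs i → ithSmallest (x ∷ xs) i ≡
    head (if countBelow (x ∷ xs) x ≡ᵇ (i ∸ 1) then x ∷ withRank (x ∷ xs) i xs else withRank (x ∷ xs) i xs)
  withRank-spec x xs i with x ∷ xs
  ... | π = refl

mutual
  tryLabels : ℕ → List ℕ → List ℕ → Maybe (List ℕ)
  tryLabels = _

  tryLabels-spec : ∀ n a → greedyStep n a ≡ tryLabels n a (map suc (upTo n))
  tryLabels-spec n a with map suc (upTo n)
  ... | labels = refl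

≡ᵇ-true : ∀ {x y} → x ≡ y → (x ≡ᵇ y) ≡ true
≡ᵇ-true {zero}  refl = refl
≡ᵇ-true {suc x} refl = ≡ᵇ-true {x} refl

≡ᵇ-sound : ∀ x y → (x ≡ᵇ y) ≡ true → x ≡ y
≡ᵇ-sound zero    zero    _  = refl
≡ᵇ-sound (suc x) (suc y) eq = cong suc (≡ᵇ-sound x y eq)

withRank-found : ∀ π i l {x} → x ∈ l → countBelow π x ≡ i →
  ∃[ b ] (head (withRank π (suc i) l) ≡ just b × b ∈ l × countBelow π b ≡ i)
withRank-found π i (y ∷ l) x∈ eq with countBelow π y ≡ᵇ i in eq′
... | true = y , refl , here refl , ≡ᵇ-sound _ _ eq′
withRank-found π i (y ∷ l) (here refl) eq | false = contradiction (≡-trans (sym eq′) (≡ᵇ-true eq)) λ ()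
withRank-found π i (y ∷ l) (there x∈)  eq | false
  with b , h , b∈ , eqb ← withRank-found π i l x∈ eq = b , h , there b∈ , eqb

-- For i = m the new letter exceeds the whole window; for smaller i it is the window letter of rank
-- i + 1. Labels of the algorithm count from 1, labels of edges from 0.
extB-found : ∀ {m w i} → IsPerm m (red w) → i ≤ m → All (1 ≤_) w →
             ∃[ b ] (extB w (suc i) ≡ just b × countBelow w b ≡ i × 1 ≤ b)
extB-found {m} {w} {i} p i≤m pos with m≤n⇒m<n∨m≡n i≤m
... | inj₂ refl = suc (maxL w) ,
  cong (λ t → if t then just (suc (maxL w)) else ithSmallest w (suc i)) (<ᵇ-true (s≤s (≤-reflexive len))) ,
  ≡-trans (countBelow-all (maxL-bound w)) len , z<s
  where
  len : length w ≡ m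
  len = ≡-trans (sym (length-red w)) (perm-length p)
... | inj₁ i<m with x , x∈w , eq ← ∈-map⁻ (rank w) (perm-∈ p z<s i<m)
  with b , h , b∈w , eqb ← withRank-found w i w x∈w (sym (suc-injective eq)) =
  b ,
  ≡-trans (cong (λ t → if t then just (suc (maxL w)) else ithSmallest w (suc i))
                (<ᵇ-false (≤-trans i<m (≤-reflexive (sym len))))) h ,
  eqb , All.lookup pos b∈w
  where
  len : length w ≡ m
  len = ≡-trans (sym (length-red w)) (perm-length p)

eqList-true : ∀ w → eqList w w ≡ true
eqList-true []      = refl
eqList-true (x ∷ w) rewrite ≡ᵇ-true {x} refl = eqList-true w

eqList-sound : ∀ v w → eqList v w ≡ true → v ≡ w
eqList-sound []      []      _  = refl
eqList-sound (x ∷ v) (y ∷ w) eq with x ≡ᵇ y in eq′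
... | true = cong₂ _∷_ (≡ᵇ-sound x y eq′) (eqList-sound v w eq)

memList-true : ∀ {w vs} → w ∈ vs → memList w vs ≡ true
memList-true {w} (here refl) rewrite eqList-true w = refl
memList-true {w} {v ∷ vs} (there p) rewrite memList-true p = ∨-zeroʳ (eqList w v)

memList-false : ∀ {w} vs → w ∉ vs → memList w vs ≡ false
memList-false []       w∉ = refl
memList-false {w} (v ∷ vs) w∉ with eqList w v in eq
... | true  = contradiction (here (eqList-sound w v eq)) w∉
... | false = memList-false vs (w∉ ∘ there)

extension-just : ∀ {w i b} → extB w i ≡ just b → extension w i ≡ just (map (c b) w ++ [ b ])
extension-just eq rewrite eq = refl

module _ (n : ℕ) (a : List ℕ) where

  window : List ℕ
  window = drop (length a ∸ (n ∸ 1)) a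

  used : List (List ℕ)
  used = map red (factors n a)

  tryLabels-skip : ∀ {i b} is → extB window i ≡ just b → red (map (c b) window ++ [ b ]) ∈ used →
                   tryLabels n a (i ∷ is) ≡ tryLabels n a is
  -- The abstractions follow those inside `greedyStep` in order, so that the call reduces.
  tryLabels-skip {i} {b} is eq e∈ with extension window i | extension-just {window} {i} eq
  ... | _ | refl with memList (red (map (c b) window ++ [ b ])) used | memList-true e∈
  ...   | _ | refl = refl

  tryLabels-take : ∀ {i b} is → extB window i ≡ just b → red (map (c b) window ++ [ b ]) ∉ used →
                   tryLabels n a (i ∷ is) ≡ just (map (c b) a ++ [ b ])
  tryLabels-take {i} {b} is eq e∉ with extension window i | extension-just {window} {i} eq
  ... | _ | refl with memList (red (map (c b) window ++ [ b ])) used | memList-false used e∉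
  ...   | _ | refl with extB window i | eq
  ...     | _ | refl = refl

range-split : ∀ {m o} → o ≤ m → ∃[ l ] range (suc m) ≡ range o ++ suc o ∷ l
range-split {m} {o} o≤m with m≤n⇒m<n∨m≡n o≤m
... | inj₂ refl = [] , range-∷ʳ m
range-split {suc m} {o} o≤m | inj₁ (s≤s o≤m′) with l , eq ← range-split o≤m′ =
  l ∷ʳ suc (suc m) , ≡-trans (range-∷ʳ (suc m)) (≡-trans (cong (_++ [ 2 + m ]) eq) (++-assoc (range o) (suc o ∷ l) [ 2 + m ]))

greedyRun-step : ∀ {n a a′} k → greedyStep n a ≡ just a′ → greedyRun n (suc k) a ≡ greedyRun n k a′
greedyRun-step k eq rewrite eq = refl

greedyRun-stop : ∀ {n a} k → greedyStep n a ≡ nothing → greedyRun n (suc k) a ≡ a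
greedyRun-stop k eq rewrite eq = refl

drop-++-≤ : ∀ k (xs : List A) {ys} → k ≤ length xs → drop k (xs ++ ys) ≡ drop k xs ++ ys
drop-++-≤ zero    xs       _       = refl
drop-++-≤ (suc k) (x ∷ xs) (s≤s p) = drop-++-≤ k xs p

take-++-≤ : ∀ k (xs : List A) {ys} → k ≤ length xs → take k (xs ++ ys) ≡ take k xs
take-++-≤ zero    xs       _       = refl
take-++-≤ (suc k) (x ∷ xs) (s≤s p) = cong (x ∷_) (take-++-≤ k xs p)

head-drop-map : ∀ (f : A → B) k a {x l} → head (drop k a) ≡ just x → head (drop k (map f a ++ l)) ≡ just (f x)
head-drop-map f zero    (y ∷ a) refl = refl
head-drop-map f (suc k) (y ∷ a) eq   = head-drop-map f k a eq

module Simulation (m : ℕ) (2≤m : 2 ≤ m) where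

  open Graph m 2≤m public

  n : ℕ
  n = suc m

  append : ℕ → List ℕ → List ℕ
  append b a = map (c b) a ++ [ b ]

  length-append : ∀ b a → length (append b a) ≡ suc (length a)
  length-append b a = ≡-trans (length-++ (map (c b) a)) (≡-trans (+-comm _ 1) (cong suc (length-map (c b) a)))

  window-drop : ∀ {L} a → length a ≡ L + m → window n a ≡ drop L a
  window-drop {L} a len = cong (λ k → drop k a) (≡-trans (cong (_∸ m) len) (m+n∸n≡m L m))

  drop-append : ∀ {L} b a → length a ≡ L + m → drop L (append b a) ≡ append b (window n a)
  drop-append {L} b a len = begin
    drop L (map (c b) a ++ [ b ])
      ≡⟨ drop-++-≤ L (map (c b) a) (≤-trans (m≤m+n L m) (≤-reflexive (≡-trans (sym len) (sym (length-map (c b) a))))) ⟩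
    drop L (map (c b) a) ++ [ b ]    ≡⟨ cong (_++ [ b ]) (drop-map L a) ⟩
    map (c b) (drop L a) ++ [ b ]    ≡⟨ cong (append b) (sym (window-drop a len)) ⟩
    append b (window n a)            ∎
    where open ≡-Reasoning

  window-append : ∀ {L} b a → length a ≡ L + m → window n (append b a) ≡ drop 1 (append b (window n a))
  window-append {L} b a len = begin
    window n (append b a)           ≡⟨ window-drop (append b a) (≡-trans (length-append b a) (cong suc len)) ⟩
    drop (suc L) (append b a)       ≡⟨ cong (λ k → drop k (append b a)) (+-comm 1 L) ⟩
    drop (L + 1) (append b a)       ≡⟨ sym (drop-drop L 1 (append b a)) ⟩
    drop 1 (drop L (append b a))    ≡⟨ cong (drop 1) (drop-append b a len) ⟩
    drop 1 (append b (window n a))  ∎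
    where open ≡-Reasoning

  -- Zero-based counterpart of `sigma`: `sigma n a (suc k)` unfolds to `factor a k`.
  factor : List ℕ → ℕ → List ℕ
  factor a k = red (take n (drop k a))

  used-factor : ∀ {L} a → length a ≡ L + m → used n a ≡ map (factor a) (upTo L)
  used-factor {L} a len = ≡-trans (sym (map-∘ (upTo (length a ∸ m))))
    (cong (map (factor a) ∘ upTo) (≡-trans (cong (_∸ m) len) (m+n∸n≡m L m)))

  length-window : ∀ {L} a → length a ≡ L + m → length (window n a) ≡ m
  length-window {L} a len = ≡-trans (cong length (window-drop a len))
    (≡-trans (length-drop L a) (≡-trans (cong (_∸ L) len) (m+n∸m≡n L m)))

  factor-append-old : ∀ {L} b a → length a ≡ L + m → ∀ {k} → k < L → factor (append b a) k ≡ factor a k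
  factor-append-old {L} b a len {k} k<L = begin
    red (take n (drop k (map (c b) a ++ [ b ])))  ≡⟨ cong (red ∘ take n) (drop-++-≤ k (map (c b) a) k≤) ⟩
    red (take n (drop k (map (c b) a) ++ [ b ]))  ≡⟨ cong red (take-++-≤ n (drop k (map (c b) a)) n≤) ⟩
    red (take n (drop k (map (c b) a)))           ≡⟨ cong (red ∘ take n) (drop-map k a) ⟩
    red (take n (map (c b) (drop k a)))           ≡⟨ cong red (take-map n (drop k a)) ⟩
    red (map (c b) (take n (drop k a)))           ≡⟨ red-map-c b (take n (drop k a)) ⟩
    red (take n (drop k a))                       ∎
    where
    open ≡-Reasoning
    len′ : length (map (c b) a) ≡ L + m
    len′ = ≡-trans (length-map (c b) a) len
    k≤ : k ≤ length (map (c b) a)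
    k≤ = ≤-trans (<⇒≤ k<L) (≤-trans (m≤m+n L m) (≤-reflexive (sym len′)))
    n≤ : n ≤ length (drop k (map (c b) a))
    n≤ = subst (n ≤_) (sym (≡-trans (length-drop k (map (c b) a)) (cong (_∸ k) len′)))
           (m+n≤o⇒m≤o∸n n (≤-trans (≤-reflexive (cong suc (+-comm m k))) (+-monoˡ-≤ m k<L)))

  factor-append-new : ∀ {L} b a → length a ≡ L + m →
                      factor (append b a) L ≡ ext (red (window n a)) (countBelow (window n a) b)
  factor-append-new {L} b a len = begin
    red (take n (drop L (append b a)))   ≡⟨ cong (red ∘ take n) (drop-append b a len) ⟩
    red (take n (append b (window n a)))
      ≡⟨ cong red (take-all n (append b (window n a))
            (≤-reflexive (≡-trans (length-append b (window n a)) (cong suc (length-window a len))))) ⟩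
    red (append b (window n a))          ≡⟨ red-ext (window n a) b ⟩
    ext (red (window n a)) (countBelow (window n a) b) ∎
    where open ≡-Reasoning

  used-append : ∀ {L} b a → length a ≡ L + m →
                used n (append b a) ≡ used n a ++ [ ext (red (window n a)) (countBelow (window n a) b) ]
  used-append {L} b a len = begin
    used n (append b a)                        ≡⟨ used-factor (append b a) (≡-trans (length-append b a) (cong suc len)) ⟩
    map f (upTo (suc L))                       ≡⟨ cong (map f) (sym (upTo-∷ʳ L)) ⟩
    map f (upTo L ∷ʳ L)                        ≡⟨ map-++ f (upTo L) [ L ] ⟩
    map f (upTo L) ++ [ f L ]
      ≡⟨ cong₂ (λ xs x → xs ++ [ x ]) (map-cong-local (All.tabulate λ k∈ → factor-append-old b a len (∈-upTo⁻ k∈)))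
                                      (factor-append-new b a len) ⟩
    map (factor a) (upTo L) ++ [ _ ]           ≡⟨ cong (_++ [ _ ]) (sym (used-factor a len)) ⟩
    used n a ++ [ _ ]                          ∎
    where
    open ≡-Reasoning
    f = factor (append b a)

  -- The word a matches a walk es that ends in v. The reversal in `hist` is due to es being listed
  -- newest first; `pos` makes a letter 1 the minimum of any window containing it.
  record Sim (a v : List ℕ) (es : List Edge) : Set where
    field
      len  : length a ≡ length es + m
      win  : red (window n a) ≡ v
      hist : used n a ≡ reverse (map perm-of es)
      pos  : All (1 ≤_) a

  open Sim

  window-pos : ∀ {a} → All (1 ≤_) a → All (1 ≤_) (window n a)
  window-pos {a} = drop⁺ (length a ∸ m)

  sim-start : Sim (range m) s []
  sim-start = record
    { len  = length-range m
    ; win  = ≡-trans (cong red (window-drop {0} (range m) (length-range m))) (red-perm ↭-refl)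
    ; hist = used-factor {0} (range m) (length-range m)
    ; pos  = All.tabulate (perm-≥1 {m} ↭-refl)
    }

  sim-append : ∀ {a v es} b → Sim a v es → 1 ≤ b →
    Sim (append b a) (next v (countBelow (window n a) b)) ((v , countBelow (window n a) b) ∷ es)
  sim-append {a} {v} {es} b sim 1≤b with refl ← win sim = record
    { len  = ≡-trans (length-append b a) (cong suc (len sim))
    ; win  = ≡-trans (cong red (window-append b a (len sim))) (sym (next-red (window n a) b))
    ; hist = ≡-trans (used-append b a (len sim))
            (≡-trans (cong (_++ [ _ ]) (hist sim)) (sym (unfold-reverse _ (map perm-of es))))
    ; pos  = All-++⁺ (All-map⁺ (All.map (λ {x} p → ≤-trans p (c-≥ b x)) (pos sim))) (1≤b ∷ [])
    }
    where
    c-≥ : ∀ b x → x ≤ c b x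
    c-≥ b x with x <ᵇ b
    ... | true  = ≤-refl
    ... | false = n≤1+n x

  module _ {a v es} (run : Run full v es) (sim : Sim a v es) where

    private
      found : ∀ {j} → j ≤ m → ∃[ b ] (extB (window n a) (suc j) ≡ just b × countBelow (window n a) b ≡ j × 1 ≤ b)
      found j≤m = extB-found (subst (IsPerm m) (sym (win sim)) (Full.run-OK run)) j≤m (window-pos (pos sim))

      edge : ∀ {j b} → countBelow (window n a) b ≡ j → red (append b (window n a)) ≡ perm-of (v , j)
      edge {b = b} refl = ≡-trans (red-ext (window n a) b) (cong (λ u → ext u _) (win sim))

    ∈-used⁺ : ∀ {e} → e ∈ es → perm-of e ∈ used n a
    ∈-used⁺ e∈ = subst (_ ∈_) (sym (hist sim)) (∈-resp-↭ (↭-sym (↭-reverse _)) (∈-map⁺ perm-of e∈))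

    ∈-used⁻ : ∀ {e} → perm-of e ∈ used n a → e ∈ es
    ∈-used⁻ {e} p with f , f∈ , eq ← ∈-map⁻ perm-of (∈-resp-↭ (↭-reverse _) (subst (perm-of e ∈_) (hist sim) p))
      = subst (_∈ es) (sym (perm-of-injective {e} {f} eq)) f∈

    skips : ∀ l {l′} → All (λ i → ∃[ j ] (i ≡ suc j × j ≤ m × (v , j) ∈ es)) l →
            tryLabels n a (l ++ l′) ≡ tryLabels n a l′
    skips [] [] = refl
    skips (_ ∷ l) {l′} ((j , refl , j≤m , e∈) ∷ all) with b , eqB , count , _ ← found j≤m =
      ≡-trans (tryLabels-skip n a (l ++ l′) eqB (subst (_∈ used n a) (sym (edge count)) (∈-used⁺ e∈))) (skips l all)

    taken : ∀ {o} → o ≤ suc m → o ≤ outs v es → All (λ i → ∃[ j ] (i ≡ suc j × j ≤ m × (v , j) ∈ es)) (range o)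
    taken {o} o≤n o≤ = All.tabulate λ i∈ → let j , eq , j<o = ∈-range⁻ i∈ in
      j , eq , s≤s⁻¹ (≤-trans j<o o≤n) , ∈-run⁺ run (≤-trans j<o o≤)

    -- With o departures from v so far, its used edges have the labels 0, ..., o - 1. The search
    -- thus rejects its candidates 1, ..., o and accepts o + 1, just as the walk does.
    greedy-step : outs v es < full v →
      ∃[ b ] (greedyStep n a ≡ just (append b a) × countBelow (window n a) b ≡ outs v es × 1 ≤ b)
    greedy-step o<n with b , eqB , count , 1≤b ← found (s≤s⁻¹ o<n) with l , split ← range-split (s≤s⁻¹ o<n) =
      b , (begin
        tryLabels n a (range n)                ≡⟨ cong (tryLabels n a) split ⟩
        tryLabels n a (range o ++ suc o ∷ l)   ≡⟨ skips (range o) (taken (<⇒≤ o<n) ≤-refl) ⟩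
        tryLabels n a (suc o ∷ l)              ≡⟨ tryLabels-take n a l eqB fresh ⟩
        just (append b a)                      ∎) , count , 1≤b
      where
      open ≡-Reasoning
      o = outs v es
      fresh : red (append b (window n a)) ∉ used n a
      fresh p = <-irrefl refl (∈-run⁻ run (∈-used⁻ (subst (_∈ used n a) (edge count) p)))

    greedy-stop : outs v es ≡ full v → greedyStep n a ≡ nothing
    greedy-stop eq = ≡-trans (cong (tryLabels n a) (sym (++-identityʳ (range n))))
                             (skips (range n) (taken ≤-refl (≤-reflexive (sym eq))))

  -- The field `greedy` says that the algorithm arrives at a after `length es` steps, whatever fuel
  -- k is left.
  record Reached (a v : List ℕ) (es : List Edge) : Set where
    field
      sim    : Sim a v es
      greedy : ∀ k → greedyRun n (length es + k) (range m) ≡ greedyRun n k a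

  open Reached

  reached-start : Reached (range m) s []
  reached-start = record { sim = sim-start ; greedy = λ k → refl }

  reached-step : ∀ {a v es} → Run full v es → Reached a v es → outs v es < full v →
    ∃[ b ] (Reached (append b a) (next v (outs v es)) ((v , outs v es) ∷ es) ×
            countBelow (window n a) b ≡ outs v es × 1 ≤ b)
  reached-step {a} {v} {es} run r o<n = let b , eq , count , 1≤b = greedy-step run (sim r) o<n in b , record
    { sim    = subst (λ o → Sim (append b a) (next v o) ((v , o) ∷ es)) count (sim-append b (sim r) 1≤b)
    ; greedy = λ k → ≡-trans (cong (λ l → greedyRun n l (range m)) (sym (+-suc (length es) k)))
                    (≡-trans (greedy r (suc k)) (greedyRun-step k eq))
    } , count , 1≤b

  -- The window keeps a letter 1: a window starting with 1 has its minimum before its maximum, so its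
  -- only edge within the cap appends a new 1.
  reached-cap : ∀ {v es} → Run cap v es → ∃[ a ] (Reached a v es × 1 ∈ window n a)
  reached-cap start = range m , reached-start ,
    subst (1 ∈_) (sym (window-drop {0} (range m) (length-range m))) (∈-range⁺ ≤-refl 1≤m)
  reached-cap (step {v} {es} run o<cap) =
    let a , r , 1∈            = reached-cap run
        b , r′ , count , 1≤b = reached-step (Run-mono cap≤full run) r (<-≤-trans o<cap (cap≤full v))
    in append b a , r′ , subst (1 ∈_) (sym (window-append b a (len (sim r))))
         (keep (window n a) (window-pos (pos (sim r))) (sym (win (sim r))) 1∈ 1≤b (outs v es) count o<cap)
    where
    keep : ∀ {b} w → All (1 ≤_) w → v ≡ red w → 1 ∈ w → 1 ≤ b →
           ∀ o → countBelow w b ≡ o → o < cap v → 1 ∈ drop 1 (append b w)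
    -- No window letter is below b, so the appended letter is itself 1.
    keep {b} (x ∷ w) w-pos v≡ 1∈w 1≤b zero count _ = ∈-++⁺ʳ (map (c b) w) (here (≤-antisym 1≤b (≮⇒≥ λ 1<b →
      contradiction (subst (countBelow (x ∷ w) 1 <_) count (countBelow-strict 1∈w 1<b)) λ ())))
    -- Some positive window letter is below b, hence 1 < b and `c b` fixes the 1.
    keep {b} (x ∷ w) w-pos v≡ (there 1∈) 1≤b (suc o) count o<cap =
      let y , y∈ , y<b = countBelow-pos {x ∷ w} {b} (subst (0 <_) (sym count) z<s)
      in ∈-++⁺ˡ (subst (_∈ map (c b) w) (c-below (≤-<-trans (All.lookup w-pos y∈) y<b)) (∈-map⁺ (c b) 1∈))
    keep (_ ∷ w) w-pos v≡ (here refl) 1≤b (suc o) count o<cap =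
      contradiction (subst (suc o <_) (cap-false v ascending) o<cap) λ { (s≤s ()) }
      where
      ascending : precedes m 1 v ≡ false
      ascending = ≡-trans (cong (precedes m 1) (≡-trans v≡ (cong (λ k → suc k ∷ map (rank (1 ∷ w)) w) (countBelow-none w-pos))))
                          (precedes-false {m} {1} [] {map (rank (1 ∷ w)) w} λ ())

  -- At s the window is increasing, so its letter 1 comes first.
  head-one : ∀ {a es} → Reached a s es → 1 ∈ window n a → head (drop (length es) a) ≡ just 1
  head-one {a} {es} r 1∈ = ≡-trans (cong head (sym (window-drop a (len (sim r))))) (go (window n a) refl 1∈)
    where
    go : ∀ w → w ≡ window n a → 1 ∈ w → head w ≡ just 1
    go (x ∷ w) w≡ 1∈w = cong just (≤-antisym
      (≮⇒≥ λ 1<x → contradiction (subst (countBelow (x ∷ w) 1 <_) zero-below (countBelow-strict 1∈w 1<x)) λ ())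
      (All.lookup (subst (All (1 ≤_)) (sym w≡) (window-pos (pos (sim r)))) (here refl)))
      where
      first-range : ∀ k → 1 ≤ k → first (range k) ≡ 1
      first-range (suc k) _ = refl
      zero-below : countBelow (x ∷ w) x ≡ 0
      zero-below = suc-injective (≡-trans (cong first (≡-trans (cong red w≡) (win (sim r)))) (first-range m 1≤m))

  endpoint : List Edge → List ℕ
  endpoint []            = s
  endpoint ((u , i) ∷ _) = next u i

  -- The current vertex can be read off the edges, so two runs with the same edges end in the same
  -- place.
  run-endpoint : ∀ {d v es} → Run d v es → v ≡ endpoint es
  run-endpoint start      = refl
  run-endpoint (step _ _) = refl

  outs-++ : ∀ v es′ es → outs v es ≤ outs v (es′ ++ es)
  outs-++ v []       es = ≤-refl
  outs-++ v (e ∷ es′) es = ≤-trans (outs-++ v es′ es)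
    (≤-trans (m≤n+m _ _) (≤-reflexive (sym (length-filter-∷ (leaves? v) e (es′ ++ es)))))

  -- Once every vertex has used its edge 0, the appended letters are at least 2.
  reached-after : ∀ {a v₁ es₁ v} es′ → Run full v (es′ ++ es₁) → Run full v₁ es₁ → Reached a v₁ es₁ →
    (∀ {x} → IsPerm m x → 0 < outs x es₁) → ∀ k → head (drop k a) ≡ just 1 →
    ∃[ a′ ] (Reached a′ v (es′ ++ es₁) × head (drop k a′) ≡ just 1)
  reached-after {a} {es₁ = es₁} [] run run₁ r used₁ k one =
    a , subst (λ v → Reached a v es₁) (≡-trans (run-endpoint run₁) (sym (run-endpoint run))) r , one
  reached-after {es₁ = es₁} (_ ∷ es′) (step {v} run o<n) run₁ r used₁ k one =
    let a , r′ , one′        = reached-after es′ run run₁ r used₁ k one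
        b , r″ , count , 1≤b = reached-step run r′ o<n
        y , y∈ , y<b         = countBelow-pos {window n a} {b}
          (subst (0 <_) (sym count) (<-≤-trans (used₁ (Full.run-OK run)) (outs-++ v es′ es₁)))
    in append b a , r″ , ≡-trans (head-drop-map (c b) k a one′)
         (cong just (c-below (≤-<-trans (All.lookup (window-pos (pos (sim r′))) y∈) y<b)))

-- Order of two letters under reversal, and positions in lists

Unique-++ˡ : ∀ (xs : List A) {ys} → Unique (xs ++ ys) → Unique xs
Unique-++ˡ []       _        = []
Unique-++ˡ (x ∷ xs) (x∉ ∷ u) = ++⁻ˡ xs x∉ ∷ Unique-++ˡ xs u

Unique-++⇒∉ : ∀ {xs : List A} {ys y} → Unique (xs ++ ys) → y ∈ ys → y ∉ xs
Unique-++⇒∉ (x∉ ∷ _) y∈ (here refl) = All.lookup x∉ (∈-++⁺ʳ _ y∈) refl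
Unique-++⇒∉ {xs = _ ∷ xs} (_ ∷ u) y∈ (there p) = Unique-++⇒∉ {xs = xs} u y∈ p

precedes-not : ∀ {x y} p → x ≢ y → x ∈ p → y ∈ p → precedes y x p ≡ not (precedes x y p)
precedes-not {x} {y} (z ∷ p) x≢y x∈ y∈ with z ≟ x | z ≟ y
... | yes refl | yes refl = contradiction refl x≢y
... | yes _    | no _     = refl
... | no _     | yes _    = refl
precedes-not (z ∷ p) x≢y (here refl) _           | no z≢x | no _   = contradiction refl z≢x
precedes-not (z ∷ p) x≢y (there _)   (here refl) | no _   | no z≢y = contradiction refl z≢y
precedes-not (z ∷ p) x≢y (there x∈)  (there y∈)  | no _   | no _   = precedes-not p x≢y x∈ y∈

-- In the reversal of u x t₁ y t₂ only t₂ stands before y, and x is not in t₂ because letters are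
-- distinct.
precedes-reverse : ∀ {x y p} → Unique p → y ∈ p → precedes x y p ≡ true → precedes y x (reverse p) ≡ true
precedes-reverse {x} {y} {p} u! y∈p eq with u , t , refl , y∉u , x≢y ← precedes-split⁻ p eq
  with ∈-++⁻ u y∈p
... | inj₁ y∈u         = contradiction y∈u y∉u
... | inj₂ (here refl) = contradiction refl x≢y
... | inj₂ (there y∈t) with t₁ , t₂ , refl ← ∈-∃++ y∈t =
  subst (λ q → precedes y x q ≡ true) (sym reversed) (precedes-split⁺ (reverse t₂) (x≢y ∘ sym) x∉)
  where
  split : u ++ x ∷ t₁ ++ y ∷ t₂ ≡ (u ++ x ∷ t₁ ∷ʳ y) ++ t₂
  split = ≡-trans (cong (λ l → u ++ x ∷ l) (sym (∷ʳ-++ t₁ y t₂))) (sym (++-assoc u (x ∷ t₁ ∷ʳ y) t₂))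
  reversed : reverse (u ++ x ∷ t₁ ++ y ∷ t₂) ≡ reverse t₂ ++ y ∷ reverse (u ++ x ∷ t₁)
  reversed = begin
    reverse (u ++ x ∷ t₁ ++ y ∷ t₂)                ≡⟨ cong reverse (sym (++-assoc u (x ∷ t₁) (y ∷ t₂))) ⟩
    reverse ((u ++ x ∷ t₁) ++ y ∷ t₂)              ≡⟨ reverse-++ (u ++ x ∷ t₁) (y ∷ t₂) ⟩
    reverse (y ∷ t₂) ++ reverse (u ++ x ∷ t₁)      ≡⟨ cong (_++ reverse (u ++ x ∷ t₁)) (unfold-reverse y t₂) ⟩
    (reverse t₂ ∷ʳ y) ++ reverse (u ++ x ∷ t₁)     ≡⟨ ∷ʳ-++ (reverse t₂) y _ ⟩
    reverse t₂ ++ y ∷ reverse (u ++ x ∷ t₁)        ∎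
    where open ≡-Reasoning
  x∉ : x ∉ reverse t₂
  x∉ q = Unique-++⇒∉ (subst Unique split u!) (∈-resp-↭ (↭-reverse t₂) q) (∈-++⁺ʳ u (here refl))

head-drop-∈ : ∀ k (p : List A) {x} → head (drop k p) ≡ just x → x ∈ p
head-drop-∈ zero    (y ∷ p) refl = here refl
head-drop-∈ (suc k) (y ∷ p) eq   = there (head-drop-∈ k p eq)

head-drop-++ : ∀ (u : List A) {x t} → head (drop (length u) (u ++ x ∷ t)) ≡ just x
head-drop-++ []      = refl
head-drop-++ (y ∷ u) = head-drop-++ u

head-drop-split : ∀ i j (p : List A) {x y} → i < j → head (drop i p) ≡ just x → head (drop j p) ≡ just y →
                  ∃[ u ] ∃[ t ] (p ≡ u ++ x ∷ t × y ∈ t)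
head-drop-split zero    (suc j) (z ∷ p) _         refl eq′ = [] , p , refl , head-drop-∈ j p eq′
head-drop-split (suc i) (suc j) (z ∷ p) (s≤s i<j) eq   eq′
  with u , t , refl , y∈t ← head-drop-split i j p i<j eq eq′ = z ∷ u , t , refl , y∈t

Before⇒precedes : ∀ {x y p} → x ≢ y → Unique p → Before x y p → precedes x y p ≡ true
Before⇒precedes {x} {y} {p} x≢y u! (i , j , i<j , eqx , eqy)
  -- `entry` treats the positions 0 and 1 alike, so i < j yields only a weak inequality of offsets;
  -- equal offsets would force x and y to be equal.
  with m≤n⇒m<n∨m≡n (∸-monoˡ-≤ 1 (<⇒≤ i<j))
... | inj₂ eq = contradiction (just-injective (≡-trans (sym eqx) (≡-trans (cong (λ k → head (drop k p)) eq) eqy))) x≢y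
... | inj₁ lt with u , t , refl , y∈t ← head-drop-split (i ∸ 1) (j ∸ 1) p lt eqx eqy =
  precedes-split⁺ u x≢y (Unique-++⇒∉ u! (there y∈t))

precedes⇒Before : ∀ {x y p} → y ∈ p → precedes x y p ≡ true → Before x y p
precedes⇒Before {x} {y} {p} y∈p eq with u , t , refl , y∉u , x≢y ← precedes-split⁻ p eq with ∈-++⁻ u y∈p
... | inj₁ y∈u         = contradiction y∈u y∉u
... | inj₂ (here refl) = contradiction refl x≢y
... | inj₂ (there y∈t) with t₁ , t₂ , refl ← ∈-∃++ y∈t =
  suc (length u) , suc (length (u ++ x ∷ t₁)) ,
  s<s (≤-trans (m<m+n (length u) z<s) (≤-reflexive (sym (length-++ u)))) , head-drop-++ u ,
  ≡-trans (cong (λ l → head (drop (length (u ++ x ∷ t₁)) l)) (sym (++-assoc u (x ∷ t₁) (y ∷ t₂)))) (head-drop-++ (u ++ x ∷ t₁))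

applyUpTo-at : ∀ (f : ℕ → A) L ys {y zs} → applyUpTo f L ≡ ys ++ y ∷ zs → f (length ys) ≡ y
applyUpTo-at f (suc L) []       refl = refl
applyUpTo-at f (suc L) (_ ∷ ys) eq   = applyUpTo-at (f ∘ suc) L ys (proj₂ (∷-injective eq))

map-upTo-at : ∀ (f : ℕ → A) L ys {y zs} → map f (upTo L) ≡ ys ++ y ∷ zs → f (length ys) ≡ y
map-upTo-at f L ys eq = applyUpTo-at f L ys (≡-trans (sym (map-upTo f L)) eq)

split-at : ∀ k (xs : List A) → k < length xs → ∃[ ys ] ∃[ y ] ∃[ zs ] (xs ≡ ys ++ y ∷ zs × length ys ≡ k)
split-at zero    (x ∷ xs) _       = [] , x , xs , refl , refl
split-at (suc k) (x ∷ xs) (s≤s p) with ys , y , zs , refl , refl ← split-at k xs p = x ∷ ys , y , zs , refl , refl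

-- Translates between membership in a middle block Q of the list of values of f and indices in the
-- corresponding interval.
module _ (f : ℕ → A) (L : ℕ) (P Q R : List A) (eq : map f (upTo L) ≡ P ++ Q ++ R) where

  private
    shape : ∀ {ys y zs} → Q ≡ ys ++ y ∷ zs → f (length P + length ys) ≡ y
    shape {ys} {y} {zs} refl = subst (λ k → f k ≡ y) (length-++ P) (map-upTo-at f L (P ++ ys)
      (≡-trans eq (≡-trans (cong (P ++_) (++-assoc ys (y ∷ zs) R)) (sym (++-assoc P ys (y ∷ zs ++ R))))))

  block⁺ : ∀ {x} → x ∈ Q → ∃[ k ] (length P ≤ k × k < length P + length Q × f k ≡ x)
  block⁺ {x} x∈Q with ys , zs , eqQ ← ∈-∃++ x∈Q = length P + length ys , m≤m+n _ _ ,
    +-monoʳ-< (length P) (subst (length ys <_) (sym (≡-trans (cong length eqQ) (length-++ ys))) (m<m+n (length ys) z<s)) ,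
    shape eqQ

  block⁻ : ∀ {k} → length P ≤ k → k < length P + length Q → f k ∈ Q
  block⁻ {k} P≤k k< with ys , y , zs , eqQ , len ← split-at (k ∸ length P) Q
      (+-cancelˡ-< (length P) _ _ (subst (_< length P + length Q) (sym (m+[n∸m]≡n P≤k)) k<)) =
    subst (_∈ Q) (sym (≡-trans (cong f (≡-trans (sym (m+[n∸m]≡n P≤k)) (cong (length P +_) (sym len)))) (shape eqQ)))
      (subst (y ∈_) (sym eqQ) (∈-++⁺ʳ ys (here refl)))

-- The two halves of the output

module Main (k : ℕ) where

  m = 2 + k

  open Simulation m (s≤s (s≤s z≤n))
  open Sim
  open Reached

  ascending-s : precedes m 1 s ≡ false
  ascending-s = precedes-false {m} {1} [] {map suc (applyUpTo suc (suc k))} λ ()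

  -- The vertex 2 3 ... m 1, to which the first step after the first half leads.
  v₁ : List ℕ
  v₁ = map (2 +_) (upTo (suc k)) ++ [ 1 ]

  v₁-perm : IsPerm m v₁
  v₁-perm = trans (↭-sym (∷↭∷ʳ 1 (map (2 +_) (upTo (suc k)))))
    (↭-reflexive (≡-trans (cong (1 ∷_) (map-∘ (upTo (suc k)))) (sym (range-suc (suc k)))))

  descending-v₁ : precedes m 1 v₁ ≡ true
  descending-v₁ = ≡-trans
    (cong (precedes m 1) (≡-trans (cong (λ l → map (2 +_) l ++ [ 1 ]) (sym (upTo-∷ʳ k)))
      (≡-trans (cong (_++ [ 1 ]) (map-++ (2 +_) (upTo k) [ k ])) (++-assoc (map (2 +_) (upTo k)) [ m ] [ 1 ]))))
    (precedes-split⁺ (map (2 +_) (upTo k)) m≢1 1∉)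
    where
    1∉ : 1 ∉ map (2 +_) (upTo k)
    1∉ p with _ , _ , () ← ∈-map⁻ (2 +_) p

  s≢v₁ : s ≢ v₁
  s≢v₁ eq = contradiction (≡-trans (sym ascending-s) (≡-trans (cong (precedes m 1) eq) descending-v₁)) λ ()

  ext-s-1 : ext s 1 ≡ 1 ∷ (map (λ x → 3 + x) (upTo (suc k)) ++ [ 2 ])
  ext-s-1 = cong (_++ [ 2 ]) (≡-trans (cong (map (c 2)) (range-suc (suc k))) (cong (1 ∷_)
    (≡-trans (sym (map-∘ (range (suc k)))) (≡-trans (sym (map-∘ (upTo (suc k)))) refl))))

  next-s-1 : next s 1 ≡ v₁
  next-s-1 = begin
    red (drop 1 (ext s 1))                           ≡⟨ cong (red ∘ drop 1) ext-s-1 ⟩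
    red (map (3 +_) (upTo (suc k)) ++ [ 2 ])
      ≡⟨ cong red (≡-trans (cong (_++ [ 2 ]) (map-∘ (upTo (suc k)))) (sym (map-++ suc (map (2 +_) (upTo (suc k))) [ 1 ]))) ⟩
    red (map suc v₁)                                 ≡⟨ red-map suc v₁ (λ _ _ → refl) ⟩
    red v₁                                           ≡⟨ red-perm v₁-perm ⟩
    v₁                                               ∎
    where open ≡-Reasoning

  ext-v₁-m : ext v₁ m ≡ map (λ x → 2 + x) (upTo (suc k)) ++ (1 ∷ n ∷ [])
  ext-v₁-m = ≡-trans (cong (_++ [ n ]) (map-c-below (All.tabulate λ x∈ → s≤s (perm-≤ v₁-perm x∈))))
                     (++-assoc (map (2 +_) (upTo (suc k))) [ 1 ] [ n ])

  first-half : ∃[ es₁ ] (Run cap s es₁ × outs s es₁ ≡ cap s)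
  first-half with es₁ , run , eq ← Cap.finish start rewrite ++-identityʳ es₁ = es₁ , run , eq

  module _ (es₁ : List Edge) (run₁ : Run cap s es₁) (sat₁ : outs s es₁ ≡ cap s) where

    outs₁ : ∀ {v} → IsPerm m v → outs v es₁ ≡ cap v
    outs₁ p = Cap.saturated run₁ sat₁ p (reach-cap p)

    run₁-full : Run full s es₁
    run₁-full = Run-mono cap≤full run₁

    -- The last edge of the first half enters s, where 1 precedes m. By `first-false` an allowed
    -- edge into such a vertex starts with n.
    last₁ : ∃[ e ] ∃[ es₀ ] (es₁ ≡ e ∷ es₀ × perm-of e ≡ n ∷ s)
    last₁ = go es₁ refl
      where
      go : ∀ es → es ≡ es₁ → ∃[ e ] ∃[ es₀ ] (es ≡ e ∷ es₀ × perm-of e ≡ n ∷ s)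
      go []              refl = contradiction (≡-trans sat₁ (cap-false s ascending-s)) λ ()
      go ((u , i) ∷ es₀) refl with pu , i<cap ← Cap.run-edge run₁ (here refl)
        with j , j≤m , σ≡ ← ext-first pu (<⇒≤ (≤-trans i<cap (cap≤m u)))
        = (u , i) , es₀ , refl , ≡-trans σ≡ (≡-trans (cong₂ (λ x v → suc x ∷ map (c (suc x)) v) j≡m (sym end))
            (cong (n ∷_) (map-c-below (All.tabulate λ x∈ → s≤s (perm-≤ {m} ↭-refl x∈)))))
        where
        end : s ≡ next u i
        end = run-endpoint run₁
        j≡m : j ≡ m
        j≡m = first-false {next u i} j≤m (≡-trans (cong (precedes n 1) (sym σ≡)) (ext-cap⁺ pu i<cap))
                (≡-trans (cong (precedes m 1) (sym end)) ascending-s)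

    -- The cap of s is 1, so s has spent label 0 only and the walk continues with label 1.
    step₁ : Run full v₁ ((s , 1) ∷ es₁)
    step₁ = subst₂ (λ v i → Run full v ((s , i) ∷ es₁)) (≡-trans (cong (next s) one) next-s-1) one
              (step run₁-full (subst (_< full s) (sym one) (s≤s z<s)))
      where
      one : outs s es₁ ≡ 1
      one = ≡-trans sat₁ (cap-false s ascending-s)

    -- In the first half v₁ has spent its m allowed labels 0, ..., m - 1, which leaves label m, the
    -- new maximum.
    step₂ : ∃[ v ] Run full v ((v₁ , m) ∷ (s , 1) ∷ es₁)
    step₂ = _ , subst (λ i → Run full (next v₁ i) ((v₁ , i) ∷ (s , 1) ∷ es₁)) outs-m
                  (step step₁ (subst (_< full v₁) (sym outs-m) ≤-refl))
      where
      outs-m : outs v₁ ((s , 1) ∷ es₁) ≡ m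
      outs-m = ≡-trans (outs-other 1 es₁ s≢v₁) (≡-trans (outs₁ v₁-perm) (cap-true v₁ descending-v₁))

    module _ (es₂ : List Edge) (run : Run full s (es₂ ++ es₁)) (sat : outs s (es₂ ++ es₁) ≡ full s) where

      es = es₂ ++ es₁

      outs-full : ∀ {v} → IsPerm m v → outs v es ≡ full v
      outs-full p = Full.saturated run sat p (reach-full p)

      ∈-first⁺ : ∀ {σ} → IsPerm n σ → precedes n 1 σ ≡ true → σ ∈ map perm-of es₁
      ∈-first⁺ p eq with v , i , pv , i≤m , refl ← ext-perm⁻ p =
        ∈-map⁺ perm-of (∈-run⁺ run₁ (subst (i <_) (sym (outs₁ pv)) (ext-cap⁻ pv i≤m eq)))

      ∈-first⁻ : ∀ {σ} → σ ∈ map perm-of es₁ → IsPerm n σ × precedes n 1 σ ≡ true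
      ∈-first⁻ p with (u , i) , e∈ , refl ← ∈-map⁻ perm-of p with pu , i<cap ← Cap.run-edge run₁ e∈ =
        ext-perm⁺ pu (<⇒≤ (≤-trans i<cap (cap≤m u))) , ext-cap⁺ pu i<cap

      ∈-all⁺ : ∀ {σ} → IsPerm n σ → σ ∈ map perm-of es
      ∈-all⁺ p with v , i , pv , i≤m , refl ← ext-perm⁻ p =
        ∈-map⁺ perm-of (∈-run⁺ run (subst (i <_) (sym (outs-full pv)) (s≤s i≤m)))

      ∈-second⁺ : ∀ {σ} → IsPerm n σ → precedes n 1 σ ≡ false → σ ∈ map perm-of es₂
      ∈-second⁺ {σ} p eq with ∈-++⁻ (map perm-of es₂) (subst (σ ∈_) (map-++ perm-of es₂ es₁) (∈-all⁺ p))
      ... | inj₁ q = q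
      ... | inj₂ q = contradiction (≡-trans (sym eq) (proj₂ (∈-first⁻ q))) λ ()

      -- All permutations with n before 1 are edges of the first half, and a run repeats no edge.
      ∈-second⁻ : ∀ {σ} → σ ∈ map perm-of es₂ → IsPerm n σ × precedes n 1 σ ≡ false
      ∈-second⁻ {σ} p with (u , i) , e∈ , refl ← ∈-map⁻ perm-of p
        with pu , i<n ← Full.run-edge run (∈-++⁺ˡ e∈) = pσ , late
        where
        pσ : IsPerm n (ext u i)
        pσ = ext-perm⁺ pu (s≤s⁻¹ i<n)
        late : precedes n 1 (ext u i) ≡ false
        late with precedes n 1 (ext u i) in eq
        ... | false = refl
        ... | true with (u′ , i′) , f∈ , eqσ ← ∈-map⁻ perm-of (∈-first⁺ pσ eq) =
          contradiction e∈ (Unique-++⇒∉ (run-unique run)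
            (subst (_∈ es₁) (sym (perm-of-injective {u , i} {u′ , i′} eqσ)) f∈))

      1∈ : ∀ {σ} → IsPerm n σ → 1 ∈ σ
      1∈ p = perm-∈ p ≤-refl z<s

      n∈ : ∀ {σ} → IsPerm n σ → n ∈ σ
      n∈ p = perm-∈ p z<s ≤-refl

      -- The edges are distinct, and each permutation of length n is one of them.
      length-es : length es ≡ n !
      length-es = ≤-antisym (edge-bound es (run-unique run) (Full.run-edge run))
        (subst₂ _≤_ (perms-length n) (length-map perm-of es) (pigeonhole (perms-unique n) (∈-all⁺ ∘ ∈-perms⁻)))

      reverse-≤ : ∀ {es es′ : List Edge} → Unique es → (∀ {σ} → σ ∈ map perm-of es → reverse σ ∈ map perm-of es′) →
                  length es ≤ length es′
      reverse-≤ {es} {es′} u! h = subst₂ _≤_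
        (≡-trans (length-map reverse (map perm-of es)) (length-map perm-of es)) (length-map perm-of es′)
        (pigeonhole (Unique.map⁺ reverse-injective (Unique.map⁺ perm-of-injective u!)) λ p →
          let σ , σ∈ , eq = ∈-map⁻ reverse p in subst (_∈ map perm-of es′) (sym eq) (h σ∈))

      -- Reversal exchanges the permutations with n before 1 and those with 1 before n, so it maps
      -- each half injectively into the other.
      halves : length es₁ ≡ length es₂
      halves = ≤-antisym
        (reverse-≤ {es₁} {es₂} (run-unique run₁) λ σ∈ → let p , eq = ∈-first⁻ σ∈ ; p′ = trans (↭-reverse _) p in
          ∈-second⁺ p′ (≡-trans (precedes-not _ (λ ()) (1∈ p′) (n∈ p′))
                          (cong not (precedes-reverse (perm-unique p) (1∈ p) eq))))
        (reverse-≤ {es₂} {es₁} (Unique-++ˡ es₂ (run-unique run)) λ σ∈ →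
          let p , eq = ∈-second⁻ σ∈ ; p′ = trans (↭-reverse _) p in
          ∈-first⁺ p′ (precedes-reverse (perm-unique p) (n∈ p)
                          (≡-trans (precedes-not _ (λ ()) (n∈ p) (1∈ p)) (cong not eq))))

      half : length es₁ ≡ n ! / 2
      half = sym (≡-trans (cong (_/ 2) n!≡) (m*n/n≡m (length es₁) 2))
        where
        n!≡ : n ! ≡ length es₁ * 2
        n!≡ = begin
          n !                        ≡⟨ sym length-es ⟩
          length es                  ≡⟨ length-++ es₂ ⟩
          length es₂ + length es₁    ≡⟨ cong (_+ length es₁) (sym halves) ⟩
          length es₁ + length es₁    ≡⟨ cong (length es₁ +_) (sym (+-identityʳ _)) ⟩
          2 * length es₁             ≡⟨ *-comm 2 (length es₁) ⟩
          length es₁ * 2             ∎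
          where open ≡-Reasoning

      output : ∃[ a ] (Pi' n ≡ a × Sim a s es × head (drop (length es₁) a) ≡ just 1)
      output =
        let a₁ , r₁ , 1∈₁ = reached-cap run₁
            a , r , one   = reached-after es₂ run run₁-full r₁ (λ {x} p → subst (0 <_) (sym (outs₁ p)) (cap-pos x))
                              (length es₁) (head-one r₁ 1∈₁)
        in a ,
           -- The fuel n ! + 1 pays for n ! steps and one final call that finds no label.
           ≡-trans (cong (λ l → greedyRun n l (range m)) (≡-trans (cong suc (sym length-es)) (+-comm 1 (length es))))
             (≡-trans (greedy r 1) (greedyRun-stop {n} {a} 0 (greedy-stop run (sim r) sat))) ,
           sim r , one

      module _ (a : List ℕ) (sim-a : Sim a s es) where

        factors-a : map (factor a) (upTo (length es)) ≡ reverse (map perm-of es)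
        factors-a = ≡-trans (sym (used-factor a (len sim-a))) (hist sim-a)

        -- The edges behind e in the list are those walked before it, so their number is its
        -- zero-based position.
        factor-at : ∀ pre {e post} → es ≡ pre ++ e ∷ post → factor a (length post) ≡ perm-of e
        factor-at pre {e} {post} eq = subst (λ l → factor a l ≡ perm-of e)
          (≡-trans (length-reverse (map perm-of post)) (length-map perm-of post))
          (map-upTo-at (factor a) (length es) (reverse (map perm-of post)) (begin
            map (factor a) (upTo (length es))       ≡⟨ factors-a ⟩
            reverse (map perm-of es)                ≡⟨ cong (reverse ∘ map perm-of) eq ⟩
            reverse (map perm-of (pre ++ e ∷ post)) ≡⟨ cong reverse (map-++ perm-of pre (e ∷ post)) ⟩
            reverse (map perm-of pre ++ perm-of e ∷ map perm-of post)
              ≡⟨ reverse-++ (map perm-of pre) _ ⟩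
            reverse (perm-of e ∷ map perm-of post) ++ reverse (map perm-of pre)
              ≡⟨ cong (_++ reverse (map perm-of pre)) (unfold-reverse (perm-of e) (map perm-of post)) ⟩
            (reverse (map perm-of post) ∷ʳ perm-of e) ++ reverse (map perm-of pre)
              ≡⟨ ∷ʳ-++ (reverse (map perm-of post)) (perm-of e) _ ⟩
            reverse (map perm-of post) ++ perm-of e ∷ reverse (map perm-of pre) ∎))
          where open ≡-Reasoning

        R₁ R₂ : List (List ℕ)
        R₁ = reverse (map perm-of es₁)
        R₂ = reverse (map perm-of es₂)

        factors-split : map (factor a) (upTo (length es)) ≡ R₁ ++ R₂
        factors-split = ≡-trans factors-a (≡-trans (cong reverse (map-++ perm-of es₂ es₁)) (reverse-++ (map perm-of es₂) _))

        length-R₁ : length R₁ ≡ length es₁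
        length-R₁ = ≡-trans (length-reverse (map perm-of es₁)) (length-map perm-of es₁)

        length-R : length R₁ + length R₂ ≡ n !
        length-R = ≡-trans (sym (length-++ R₁)) (≡-trans (cong length (sym factors-split))
          (≡-trans (length-map (factor a) (upTo (length es))) (≡-trans (length-upTo (length es)) length-es)))

        first-set : ∀ p → (∃[ k ] (1 ≤ k × k ≤ length es₁ × sigma n a k ≡ p)) ⇔ (IsPerm n p × Before n 1 p)
        first-set p = mk⇔ to from
          where
          to : (∃[ k ] (1 ≤ k × k ≤ length es₁ × sigma n a k ≡ p)) → IsPerm n p × Before n 1 p
          to (suc k , _ , k< , refl) =
            let pσ , eq = ∈-first⁻ (∈-resp-↭ (↭-reverse _)
                            (block⁻ (factor a) (length es) [] R₁ R₂ factors-split z≤n (subst (k <_) (sym length-R₁) k<)))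
            in pσ , precedes⇒Before (1∈ pσ) eq
          from : IsPerm n p × Before n 1 p → ∃[ k ] (1 ≤ k × k ≤ length es₁ × sigma n a k ≡ p)
          from (pσ , bef) =
            let k , _ , k< , eq = block⁺ (factor a) (length es) [] R₁ R₂ factors-split
                  (∈-resp-↭ (↭-sym (↭-reverse _)) (∈-first⁺ pσ (Before⇒precedes (λ ()) (perm-unique pσ) bef)))
            in suc k , z<s , subst (k <_) length-R₁ k< , eq

        second-set : ∀ p → (∃[ k ] (length es₁ < k × k ≤ n ! × sigma n a k ≡ p)) ⇔ (IsPerm n p × Before 1 n p)
        second-set p = mk⇔ to from
          where
          split : map (factor a) (upTo (length es)) ≡ R₁ ++ R₂ ++ []
          split = ≡-trans factors-split (cong (R₁ ++_) (sym (++-identityʳ R₂)))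
          to : (∃[ k ] (length es₁ < k × k ≤ n ! × sigma n a k ≡ p)) → IsPerm n p × Before 1 n p
          to (suc k , s≤s h≤k , k< , refl) =
            let pσ , eq = ∈-second⁻ (∈-resp-↭ (↭-reverse _)
                            (block⁻ (factor a) (length es) R₁ R₂ [] split
                              (subst (_≤ k) (sym length-R₁) h≤k) (subst (k <_) (sym length-R) k<)))
            in pσ , precedes⇒Before (n∈ pσ) (≡-trans (precedes-not _ (λ ()) (n∈ pσ) (1∈ pσ)) (cong not eq))
          from : IsPerm n p × Before 1 n p → ∃[ k ] (length es₁ < k × k ≤ n ! × sigma n a k ≡ p)
          from (pσ , bef) =
            let k , h≤k , k< , eq = block⁺ (factor a) (length es) R₁ R₂ [] split
                  (∈-resp-↭ (↭-sym (↭-reverse _)) (∈-second⁺ pσ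
                    (≡-trans (precedes-not _ (λ ()) (1∈ pσ) (n∈ pσ)) (cong not (Before⇒precedes (λ ()) (perm-unique pσ) bef)))))
            in suc k , s≤s (subst (_≤ k) length-R₁ h≤k) , subst (k <_) length-R k< , eq

  Result : List ℕ → ℕ → Set
  Result a h =
    entry a (suc h) ≡ just 1
    × sigma n a h ≡ n ∷ map suc (upTo (n ∸ 1))
    × sigma n a (suc h) ≡ 1 ∷ (map (λ x → 3 + x) (upTo (n ∸ 2)) ++ [ 2 ])
    × sigma n a (2 + h) ≡ map (λ x → 2 + x) (upTo (n ∸ 2)) ++ (1 ∷ n ∷ [])
    × (∀ (p : List ℕ) → (∃[ k ] (1 ≤ k × k ≤ h × sigma n a k ≡ p)) ⇔ (p ↭ map suc (upTo n) × Before n 1 p))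
    × (∀ (p : List ℕ) → (∃[ k ] (h < k × k ≤ n ! × sigma n a k ≡ p)) ⇔ (p ↭ map suc (upTo n) × Before 1 n p))

  result : Result (Pi' n) (n ! / 2)
  result =
    let es₁ , run₁ , sat₁ = first-half
        es₂ , run , sat   = Full.finish (proj₂ (step₂ es₁ run₁ sat₁))
        -- The two forced steps are the oldest edges of the second half.
        es₂′ = es₂ ++ (v₁ , m) ∷ (s , 1) ∷ []
        shape : es₂′ ++ es₁ ≡ es₂ ++ (v₁ , m) ∷ (s , 1) ∷ es₁
        shape = ++-assoc es₂ ((v₁ , m) ∷ (s , 1) ∷ []) es₁
        run′ = subst (Run full s) (sym shape) run
        sat′ = ≡-trans (cong (outs s) shape) sat
        a , Pi≡a , sim-a , one = output es₁ run₁ sat₁ es₂′ run′ sat′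
        e , es₀ , es₁≡ , e≡ = last₁ es₁ run₁ sat₁
        at = λ pre {e} {post} → factor-at es₁ run₁ sat₁ es₂′ run′ sat′ a sim-a pre {e} {post}
    in subst₂ Result (sym Pi≡a) (half es₁ run₁ sat₁ es₂′ run′ sat′)
      ( one
      -- Position `length es₁` counted from 1 is `length es₀` counted from 0, the place of the last
      -- edge of the first half.
      , ≡-trans (cong (sigma n a ∘ length) es₁≡) (≡-trans (at es₂′ (cong (es₂′ ++_) es₁≡)) e≡)
      , ≡-trans (at (es₂ ++ [ v₁ , m ]) (≡-trans shape (sym (++-assoc es₂ [ v₁ , m ] ((s , 1) ∷ es₁))))) ext-s-1
      , ≡-trans (at es₂ shape) ext-v₁-m
      , first-set es₁ run₁ sat₁ es₂′ run′ sat′ a sim-a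
      , second-set es₁ run₁ sat₁ es₂′ run′ sat′ a sim-a )

theorem3p1 : (n : ℕ) → 3 ≤ n →
    entry (Pi' n) (suc (n ! / 2)) ≡ just 1
    × sigma n (Pi' n) (n ! / 2) ≡ n ∷ map suc (upTo (n ∸ 1))
    × sigma n (Pi' n) (suc (n ! / 2)) ≡ 1 ∷ (map (λ x → 3 + x) (upTo (n ∸ 2)) ++ [ 2 ])
    × sigma n (Pi' n) (2 + n ! / 2) ≡ map (λ x → 2 + x) (upTo (n ∸ 2)) ++ (1 ∷ n ∷ [])
    × (∀ (p : List ℕ) → (∃[ k ] (1 ≤ k × k ≤ n ! / 2 × sigma n (Pi' n) k ≡ p))
    ⇔ (p ↭ map suc (upTo n) × Before n 1 p))
    × (∀ (p : List ℕ) → (∃[ k ] (n ! / 2 < k × k ≤ n ! × sigma n (Pi' n) k ≡ p))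
    ⇔ (p ↭ map suc (upTo n) × Before 1 n p))
theorem3p1 (suc (suc (suc k))) (s≤s (s≤s (s≤s z≤n))) = Main.result k
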